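{- For every integer $j$, \[ \sum_{\substack{\lambda\in \mathcal{P}\\ |\lambda|_a=j}}\ \prod_{i\geq 1}\binom{\lambda_i-\lambda_{i+2}+1}{\lambda_{i+1}-\lambda_{i+2}}q^{\binom{\lambda_1}{2}+|\lambda|}=\frac{q^{\binom{2j}{2}}}{\prod_{i\geq 1}(1-q^{2i})^2}. \]
   Context: $\mathcal{P}$ is the set of all partitions $\lambda=(\lambda_1\ge\cdots\ge\lambda_k>0)$, with $\lambda_i=0$ for $i>k$ ($k=0$ for the empty partition), $|\lambda|=\sum\lambda_i$. The alternating sum is $|\lambda|_a=\sum_{i=1}^{\lambda_1}(-1)^{i-1}i+\sum_{i=2}^{k}(-1)^{\lambda_1+i-2}\lambda_i$, i.e. the alternating sum $1-2+3-\cdots+(-1)^{\lambda_1-1}\lambda_1+(-1)^{\lambda_1}\lambda_2+\cdots+(-1)^{\lambda_1+k-2}\lambda_k$ (equal to $0$ for the empty partition). $\binom{2j}{2}=j(2j-1)$ for any integer $j$. -}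

module Defs where

open import Data.Nat as ℕ using (ℕ; zero; suc; _∸_; _⊓_)
open import Data.Nat.Combinatorics using (_C_)
open import Data.Integer as ℤ using (ℤ; +_; -_)
open import Data.List using (List; []; _∷_; map; foldr; upTo; concatMap; filterᵇ; length)
open import Data.Bool using (Bool; true; false; if_then_else_; _∧_)
open import Relation.Nullary.Decidable using (⌊_⌋)

-- Partitions are represented as lists (λ₁ ∷ λ₂ ∷ … ∷ λ_k ∷ []),
-- weakly decreasing with positive entries.

sgn : ℕ → ℤ
sgn zero = + 1
sgn (suc e) = - sgn e

nth : List ℕ → ℕ → ℕ
nth [] _ = 0
nth (x ∷ _) zero = x
nth (_ ∷ xs) (suc i) = nth xs i

-- λ_i, 1-indexed (λ_i = 0 for i > k)
part : List ℕ → ℕ → ℕ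
part l i = nth l (i ∸ 1)

range1 : ℕ → List ℕ
range1 N = map suc (upTo N)

sumℤ : List ℤ → ℤ
sumℤ = foldr ℤ._+_ (+ 0)

sumℕ : List ℕ → ℕ
sumℕ = foldr ℕ._+_ 0

prodℕ : List ℕ → ℕ
prodℕ = foldr ℕ._*_ 1

size : List ℕ → ℕ
size = sumℕ

altSum : List ℕ → ℤ
altSum l =
  sumℤ (map (λ i → sgn (i ∸ 1) ℤ.* + i) (range1 (part l 1)))
  ℤ.+ sumℤ (map (λ i → sgn ((part l 1 ℕ.+ i) ∸ 2) ℤ.* + part l i)
                (map (2 ℕ.+_) (upTo (length l ∸ 1))))

-- ∏_{i≥1} binom(λ_i - λ_{i+2} + 1, λ_{i+1} - λ_{i+2});
-- factors with i > k equal binom(1,0) = 1, so the product is over i = 1..k.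
weight : List ℕ → ℕ
weight l = prodℕ (map (λ i → ((part l i ∸ part l (suc (suc i))) ℕ.+ 1)
                               C (part l (suc i) ∸ part l (suc (suc i))))
                      (range1 (length l)))

-- partitions of m with all parts ≤ b (fuel f ≥ m ensures completeness)
partsF : ℕ → ℕ → ℕ → List (List ℕ)
partsF _ zero _ = [] ∷ []
partsF zero (suc m) _ = []
partsF (suc f) (suc m) b =
  concatMap (λ p → map (p ∷_) (partsF f (suc m ∸ p) p)) (range1 (suc m ⊓ b))

partitions : ℕ → List (List ℕ)
partitions m = partsF m m m

Series : Set
Series = ℕ → ℤ

_⊛_ : Series → Series → Series
(f ⊛ g) n = sumℤ (map (λ k → f k ℤ.* g (n ∸ k)) (upTo (suc n)))

infixl 7 _⊛_

monomial : ℕ → Series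
monomial e n = if ⌊ n ℕ.≟ e ⌋ then + 1 else + 0

-- the series 1 - q^{2i}  (used for i ≥ 1)
oneMinusQ2 : ℕ → Series
oneMinusQ2 i n = if ⌊ n ℕ.≟ 0 ⌋ then + 1 else (if ⌊ n ℕ.≟ 2 ℕ.* i ⌋ then - + 1 else + 0)

-- ∏_{i=1}^{N} (1 - q^{2i})^2 ; it agrees with the infinite product
-- ∏_{i≥1}(1-q^{2i})^2 in all coefficients of degree ≤ N (indeed ≤ 2N+1).
prodTrunc : ℕ → Series
prodTrunc N = foldr (λ i s → oneMinusQ2 i ⊛ oneMinusQ2 i ⊛ s) (monomial 0) (range1 N)

-- LHS series: Σ_{λ ∈ 𝒫, |λ|_a = j} weight(λ) q^{binom(λ₁,2) + |λ|}.
-- Its coefficient of q^n only involves partitions with |λ| ≤ n.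
lhs : ℤ → Series
lhs j n = sumℤ (map (λ l → + weight l)
  (filterᵇ (λ l → ⌊ altSum l ℤ.≟ j ⌋ ∧ ⌊ (part l 1 C 2) ℕ.+ size l ℕ.≟ n ⌋)
           (concatMap partitions (upTo (suc n)))))

-- binom(2j,2) = j(2j-1) as an integer (always ≥ 0)
binom2j2 : ℤ → ℤ
binom2j2 j = j ℤ.* ((+ 2 ℤ.* j) ℤ.- + 1)

rhsNumerator : ℤ → Series
rhsNumerator j n = if ⌊ + n ℤ.≟ binom2j2 j ⌋ then + 1 else + 0

module Submission where

-- The exponent binom(λ₁,2) + |λ| and the alternating sum are the sum and the
-- alternating sum of A = (1, 2, …, λ₁, λ₂, …, λ_k), and the weight counts the
-- Young diagrams whose s-th antidiagonal has A_s boxes; |λ|_a is then the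
-- number of boxes of even content minus the number of boxes of odd content.
-- In terms of g_i = A_i + 1 − A_{i+1} (with A_0 = 0) the weight is the product of
-- multichoose g_i g_{i+1}, and restricting to diagrams with at most a rows
-- replaces multichoose g_i by multichoose (g_i − 1) for i ≥ a. No bijection is
-- needed: Pascal's rule shows that the restricted series R a j satisfies the
-- recursion given by removing a first column of length a,
--   R_a(j) = R_{a−1}(j) + q^a R_a(ε_a − j),   ε_a = a mod 2.
-- Applying it twice gives (1 − q^{2a}) R_a(j) = R_{a−1}(j) + q^a R_{a−1}(ε_a − j),
-- whence (q²;q²)_u (q²;q²)_v R_a(j) = q^{j(2j−1)} by induction on a, where u + v = a
-- and u − v is 2j for even a and 1 − 2j for odd a. Finally let a tend to infinity.

open import Defs
open import Data.Bool using (Bool; true; false; if_then_else_; _∧_)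
open import Data.Integer as ℤ using (ℤ; +_; -[1+_]; -_; _+_; _*_; _-_)
import Data.Integer.Properties as ℤ
open import Data.Integer.Tactic.RingSolver using (solve-∀)
open import Data.List using
  (List; []; _∷_; _++_; map; foldr; upTo; applyUpTo; concatMap; filterᵇ; length)
import Data.List.Properties as List
open import Data.Nat as ℕ using (ℕ; zero; suc; _∸_; _⊓_; z≤n; s≤s)
open import Data.Nat.Combinatorics using (_C_; nC1≡n; nCn≡1; nCk+nC[k+1]≡[n+1]C[k+1])
import Data.Nat.Properties as ℕ
import Data.Nat.Tactic.RingSolver as ℕ-Solver
open import Data.Product using (∃-syntax; _,_)
open import Data.Sum using (_⊎_; inj₁; inj₂)
open import Relation.Binary.PropositionalEquality
open import Relation.Nullary using (Dec; yes; no; contradiction)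
open import Relation.Nullary.Decidable using (⌊_⌋)
open ≡-Reasoning

-- Sums over p + g = N and power series

+-congˡ : ∀ a {b c} → b ≡ c → a + b ≡ a + c
+-congˡ a = cong (λ x → a + x)

antiSum : ℕ → (ℕ → ℕ → ℤ) → ℤ
antiSum zero f = f 0 0
antiSum (suc N) f = f 0 (suc N) + antiSum N (λ p g → f (suc p) g)

antiSum-cong : ∀ N {f h} → (∀ p g → p ℕ.+ g ≡ N → f p g ≡ h p g) →
               antiSum N f ≡ antiSum N h
antiSum-cong zero eq = eq 0 0 refl
antiSum-cong (suc N) eq =
  cong₂ _+_ (eq 0 (suc N) refl) (antiSum-cong N (λ p g e → eq (suc p) g (cong suc e)))

antiSum-snoc : ∀ N f →
  antiSum (suc N) f ≡ antiSum N (λ p g → f p (suc g)) + f (suc N) 0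
antiSum-snoc zero f = refl
antiSum-snoc (suc N) f =
  trans (+-congˡ (f 0 (suc (suc N))) (antiSum-snoc N (λ p g → f (suc p) g)))
        (sym (ℤ.+-assoc (f 0 (suc (suc N))) (antiSum N (λ p g → f (suc p) (suc g)))
                        (f (suc (suc N)) 0)))

antiSum-swap : ∀ N f → antiSum N (λ p g → f g p) ≡ antiSum N f
antiSum-swap zero f = refl
antiSum-swap (suc N) f = begin
  f (suc N) 0 + antiSum N (λ p g → f g (suc p))
    ≡⟨ +-congˡ (f (suc N) 0) (antiSum-swap N (λ p g → f p (suc g))) ⟩
  f (suc N) 0 + antiSum N (λ p g → f p (suc g))
    ≡⟨ ℤ.+-comm (f (suc N) 0) (antiSum N (λ p g → f p (suc g))) ⟩
  antiSum N (λ p g → f p (suc g)) + f (suc N) 0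
    ≡⟨ antiSum-snoc N f ⟨
  antiSum (suc N) f ∎

interchange : ∀ a b c d → (a + b) + (c + d) ≡ (a + c) + (b + d)
interchange = solve-∀

antiSum-+ : ∀ N f h →
  antiSum N (λ p g → f p g + h p g) ≡ antiSum N f + antiSum N h
antiSum-+ zero f h = refl
antiSum-+ (suc N) f h =
  trans (+-congˡ (f 0 (suc N) + h 0 (suc N)) (antiSum-+ N (λ p → f (suc p)) (λ p → h (suc p))))
        (interchange (f 0 (suc N)) (h 0 (suc N))
                     (antiSum N (λ p → f (suc p))) (antiSum N (λ p → h (suc p))))

antiSum-minus : ∀ N f h →
  antiSum N (λ p g → f p g - h p g) ≡ antiSum N f - antiSum N h
antiSum-minus zero f h = refl
antiSum-minus (suc N) f h =
  trans (+-congˡ (f 0 (suc N) - h 0 (suc N)) (antiSum-minus N (λ p → f (suc p)) (λ p → h (suc p))))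
        (lemma (f 0 (suc N)) (h 0 (suc N)) (antiSum N (λ p → f (suc p))) (antiSum N (λ p → h (suc p))))
  where
  lemma : ∀ a b c d → (a - b) + (c - d) ≡ (a + c) - (b + d)
  lemma = solve-∀

antiSum-*ˡ : ∀ N c f → antiSum N (λ p g → c * f p g) ≡ c * antiSum N f
antiSum-*ˡ zero c f = refl
antiSum-*ˡ (suc N) c f =
  trans (+-congˡ (c * f 0 (suc N)) (antiSum-*ˡ N c (λ p g → f (suc p) g)))
        (sym (ℤ.*-distribˡ-+ c (f 0 (suc N)) (antiSum N (λ p → f (suc p)))))

antiSum-0 : ∀ N → antiSum N (λ _ _ → + 0) ≡ + 0
antiSum-0 zero = refl
antiSum-0 (suc N) = trans (ℤ.+-identityˡ _) (antiSum-0 N)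

infix 4 _≐_
_≐_ : Series → Series → Set
f ≐ g = ∀ n → f n ≡ g n

shift : ℕ → Series → Series
shift zero f n = f n
shift (suc k) f zero = + 0
shift (suc k) f (suc n) = shift k f n

shift-cong : ∀ k {f g} → f ≐ g → shift k f ≐ shift k g
shift-cong zero eq n = eq n
shift-cong (suc k) eq zero = refl
shift-cong (suc k) eq (suc n) = shift-cong k eq n

shift-zero : ∀ k → shift k (λ _ → + 0) ≐ (λ _ → + 0)
shift-zero zero n = refl
shift-zero (suc k) zero = refl
shift-zero (suc k) (suc n) = shift-zero k n

shift-+ : ∀ k f g → shift k (λ n → f n + g n) ≐ (λ n → shift k f n + shift k g n)
shift-+ zero f g n = refl
shift-+ (suc k) f g zero = refl
shift-+ (suc k) f g (suc n) = shift-+ k f g n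

shift-minus : ∀ k f g → shift k (λ n → f n - g n) ≐ (λ n → shift k f n - shift k g n)
shift-minus zero f g n = refl
shift-minus (suc k) f g zero = refl
shift-minus (suc k) f g (suc n) = shift-minus k f g n

shift-*ˡ : ∀ k c f → (λ n → c * shift k f n) ≐ shift k (λ n → c * f n)
shift-*ˡ zero c f n = refl
shift-*ˡ (suc k) c f zero = ℤ.*-zeroʳ c
shift-*ˡ (suc k) c f (suc n) = shift-*ˡ k c f n

shift-shift : ∀ k l f → shift k (shift l f) ≐ shift (k ℕ.+ l) f
shift-shift zero l f n = refl
shift-shift (suc k) l f zero = refl
shift-shift (suc k) l f (suc n) = shift-shift k l f n

shift-comm : ∀ k l f → shift k (shift l f) ≐ shift l (shift k f)
shift-comm k l f n = begin
  shift k (shift l f) n ≡⟨ shift-shift k l f n ⟩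
  shift (k ℕ.+ l) f n   ≡⟨ cong (λ s → shift s f n) (ℕ.+-comm k l) ⟩
  shift (l ℕ.+ k) f n   ≡⟨ shift-shift l k f n ⟨
  shift l (shift k f) n ∎

shift-antiSum : ∀ k N (F : ℕ → ℕ → Series) n →
  antiSum N (λ p g → shift k (F p g) n) ≡ shift k (λ n → antiSum N (λ p g → F p g n)) n
shift-antiSum zero N F n = refl
shift-antiSum (suc k) N F zero = antiSum-0 N
shift-antiSum (suc k) N F (suc n) = shift-antiSum k N F n

-- Antidiagonal counts and removal of the first column

-- The number of multisets of `e` elements from `g` kinds. In use, `e` and `g` count the available
-- empty positions on two consecutive antidiagonals.
multichoose : ℕ → ℕ → ℕ
multichoose zero g = 1
multichoose (suc e) zero = 0
multichoose (suc e) (suc g) = multichoose e (suc g) ℕ.+ multichoose (suc e) g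

multichoose-1 : ∀ e → multichoose e 1 ≡ 1
multichoose-1 zero = refl
multichoose-1 (suc e) = trans (ℕ.+-identityʳ _) (multichoose-1 e)

-- For t = 0 the first position of the antidiagonal must be empty; one of the
-- e empty positions is thereby fixed.
factor : ℕ → ℕ → ℕ → ℕ
factor zero zero g = 0
factor zero (suc e) g = multichoose e g
factor (suc t) e g = multichoose e g

-- The multisets that use the first kind, and those that avoid it.
factor-pascal : ∀ e g → multichoose e (suc g) ≡ factor 0 e (suc g) ℕ.+ multichoose e g
factor-pascal zero g = refl
factor-pascal (suc e) g = refl

δ : ℤ → Series
δ (+ zero) zero = + 1
δ (+ zero) (suc _) = + 0
δ (+ suc _) _ = + 0
δ -[1+ _ ] _ = + 0

δ-neg : ∀ j → δ (+ 0 - j) ≐ δ j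
δ-neg (+ zero) n = refl
δ-neg (+ suc _) n = refl
δ-neg -[1+ _ ] n = refl

-- The ways to continue from an antidiagonal with y boxes and e available but empty
-- positions, so that y + e − 1 is the size of the previous antidiagonal. The first
-- column meets at most t antidiagonals from here on, this one included, and j is
-- the alternating sum of their sizes. Ψ-delayed counts down the y boxes so that
-- the recursion is structural in the degree.
mutual
  Ψ : (t y e : ℕ) → ℤ → Series
  Ψ t zero (suc e) j m = δ j m
  Ψ zero zero zero j m = + 0
  Ψ (suc t) zero zero j m = Ψ t 1 0 (+ 0 - j) m + δ (+ 0 - j) m
  Ψ t (suc y) e j zero = + 0
  Ψ t (suc y) e j (suc m) = Ψ-delayed t (suc y) e (+ suc y - j) y m

  Ψ-delayed : (t y e : ℕ) → ℤ → (d : ℕ) → Series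
  Ψ-delayed t y e i zero m = antiSum (suc y) (λ p g → + factor t e g * Ψ (ℕ.pred t) p g i m)
  Ψ-delayed t y e i (suc d) zero = + 0
  Ψ-delayed t y e i (suc d) (suc m) = Ψ-delayed t y e i d m

body : (t y e : ℕ) → ℤ → Series
body t y e i m = antiSum (suc y) (λ p g → + factor t e g * Ψ (ℕ.pred t) p g i m)

Ψ-delayed-shift : ∀ t y e i d → Ψ-delayed t y e i d ≐ shift d (body t y e i)
Ψ-delayed-shift t y e i zero m = refl
Ψ-delayed-shift t y e i (suc d) zero = refl
Ψ-delayed-shift t y e i (suc d) (suc m) = Ψ-delayed-shift t y e i d m

Ψ-suc : ∀ t y e j → Ψ t (suc y) e j ≐ shift (suc y) (body t (suc y) e (+ suc y - j))
Ψ-suc t y e j zero = refl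
Ψ-suc t y e j (suc m) = Ψ-delayed-shift t (suc y) e (+ suc y - j) y m

-- With `t = 0` the first position must be empty, but `e = 0` leaves no position empty.
Ψ-0-0 : ∀ y j → Ψ 0 y 0 j ≐ (λ _ → + 0)
Ψ-0-0 zero j m = refl
Ψ-0-0 (suc y) j m =
  trans (Ψ-suc 0 y 0 j m)
  (trans (shift-cong (suc y) (λ n → antiSum-0 (2 ℕ.+ y)) m) (shift-zero (suc y) m))

-- The defining clauses for `y = 0` agree with the general recursion, so later arguments can treat
-- all `y` alike.
Ψ-body : ∀ t y e j → Ψ t y e j ≐ shift y (body t y e (+ y - j))
Ψ-body t (suc y) e j m = Ψ-suc t y e j m
Ψ-body zero zero zero j m = refl
Ψ-body (suc t) zero zero j m = begin
  Ψ t 1 0 (+ 0 - j) m + δ (+ 0 - j) m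
    ≡⟨ ℤ.+-comm (Ψ t 1 0 (+ 0 - j) m) (δ (+ 0 - j) m) ⟩
  δ (+ 0 - j) m + Ψ t 1 0 (+ 0 - j) m
    ≡⟨ cong₂ _+_ (ℤ.*-identityˡ (δ (+ 0 - j) m)) (ℤ.*-identityˡ (Ψ t 1 0 (+ 0 - j) m)) ⟨
  + 1 * δ (+ 0 - j) m + + 1 * Ψ t 1 0 (+ 0 - j) m ∎
Ψ-body zero zero (suc e) j m = begin
  δ j m
    ≡⟨ δ-neg j m ⟨
  δ (+ 0 - j) m
    ≡⟨ units (δ (+ 0 - j) m) (+ multichoose e 0) ⟩
  + 1 * δ (+ 0 - j) m + + multichoose e 0 * + 0
    ≡⟨ cong₂ (λ a b → + a * δ (+ 0 - j) m + + multichoose e 0 * b)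
             (multichoose-1 e) (Ψ-0-0 1 (+ 0 - j) m) ⟨
  + multichoose e 1 * δ (+ 0 - j) m + + multichoose e 0 * Ψ 0 1 0 (+ 0 - j) m ∎
  where
  units : ∀ a b → a ≡ + 1 * a + b * + 0
  units = solve-∀
Ψ-body (suc t) zero (suc e) j m = begin
  δ j m
    ≡⟨ δ-neg j m ⟨
  δ (+ 0 - j) m
    ≡⟨ units (δ (+ 0 - j) m) (Ψ t 1 0 (+ 0 - j) m) ⟩
  + 1 * δ (+ 0 - j) m + + 0 * Ψ t 1 0 (+ 0 - j) m
    ≡⟨ cong (λ a → + a * δ (+ 0 - j) m + + 0 * Ψ t 1 0 (+ 0 - j) m) (multichoose-1 (suc e)) ⟨
  + multichoose (suc e) 1 * δ (+ 0 - j) m + + 0 * Ψ t 1 0 (+ 0 - j) m ∎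
  where
  units : ∀ a b → a ≡ + 1 * a + + 0 * b
  units = solve-∀

-- Once the forced empty position is set aside, the other `g` are placed freely, as for `t = 1`;
-- from the next antidiagonal on both bounds are `0`.
Ψ-0-suc : ∀ y g j → Ψ 0 y (suc g) j ≐ Ψ 1 y g j
Ψ-0-suc zero zero j m = begin
  δ j m ≡⟨ δ-neg j m ⟨
  δ (+ 0 - j) m ≡⟨ ℤ.+-identityˡ _ ⟨
  + 0 + δ (+ 0 - j) m ≡⟨ cong (_+ δ (+ 0 - j) m) (Ψ-0-0 1 (+ 0 - j) m) ⟨
  Ψ 0 1 0 (+ 0 - j) m + δ (+ 0 - j) m ∎
Ψ-0-suc zero (suc g) j m = refl
Ψ-0-suc (suc y) g j m = trans (Ψ-suc 0 y (suc g) j m) (sym (Ψ-suc 1 y g j m))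

-- The alternating sum of `t` ones, that is, the contribution of a column of `t` boxes.
parity : ℕ → ℤ
parity zero = + 0
parity (suc t) = + 1 - parity t

-- Base case of the column removal. The term `p = 2 + y` is zero by `Ψ-0-0`; in the others Pascal's
-- rule splits the coefficient, and `Ψ-0-suc` identifies the second half with the terms of
-- `body 2 y e`.
body-column-1 : ∀ y e i m →
  body 1 (suc y) e i m ≡ body 0 (suc y) e i m + body 2 y e i m
body-column-1 y e i m = begin
  antiSum (2 ℕ.+ y) F
    ≡⟨ antiSum-snoc (suc y) F ⟩
  antiSum (suc y) (λ p g → F p (suc g)) + F (2 ℕ.+ y) 0
    ≡⟨ cong₂ _+_ (antiSum-cong (suc y) (λ p g _ → split p g)) (last-0 (+ multichoose e 0)) ⟩
  antiSum (suc y) (λ p g → G p (suc g) + H p g) + + 0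
    ≡⟨ cong (_+ + 0) (antiSum-+ (suc y) (λ p g → G p (suc g)) H) ⟩
  (antiSum (suc y) (λ p g → G p (suc g)) + antiSum (suc y) H) + + 0
    ≡⟨ rearrange (antiSum (suc y) (λ p g → G p (suc g))) (antiSum (suc y) H) (+ 0) ⟩
  (antiSum (suc y) (λ p g → G p (suc g)) + + 0) + antiSum (suc y) H
    ≡⟨ cong (λ x → (antiSum (suc y) (λ p g → G p (suc g)) + x) + antiSum (suc y) H) (last-0 (+ factor 0 e 0)) ⟨
  (antiSum (suc y) (λ p g → G p (suc g)) + G (2 ℕ.+ y) 0) + antiSum (suc y) H
    ≡⟨ cong (_+ antiSum (suc y) H) (antiSum-snoc (suc y) G) ⟨
  antiSum (2 ℕ.+ y) G + antiSum (suc y) H ∎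
  where
  F G H : ℕ → ℕ → ℤ
  F p g = + multichoose e g * Ψ 0 p g i m
  G p g = + factor 0 e g * Ψ 0 p g i m
  H p g = + multichoose e g * Ψ 1 p g i m

  last-0 : ∀ c → c * Ψ 0 (2 ℕ.+ y) 0 i m ≡ + 0
  last-0 c = trans (cong (c *_) (Ψ-0-0 (2 ℕ.+ y) i m)) (ℤ.*-zeroʳ c)

  rearrange : ∀ a b c → (a + b) + c ≡ (a + c) + b
  rearrange = solve-∀

  split : ∀ p g → F p (suc g) ≡ G p (suc g) + H p g
  split p g = begin
    + multichoose e (suc g) * Ψ 0 p (suc g) i m
      ≡⟨ cong (λ c → + c * Ψ 0 p (suc g) i m) (factor-pascal e g) ⟩
    (+ factor 0 e (suc g) + + multichoose e g) * Ψ 0 p (suc g) i m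
      ≡⟨ ℤ.*-distribʳ-+ (Ψ 0 p (suc g) i m) (+ factor 0 e (suc g)) (+ multichoose e g) ⟩
    G p (suc g) + + multichoose e g * Ψ 0 p (suc g) i m
      ≡⟨ cong (λ x → G p (suc g) + + multichoose e g * x) (Ψ-0-suc p g i m) ⟩
    G p (suc g) + H p g ∎

mutual
  -- The second summand counts the continuations whose first column meets exactly
  -- t + 1 antidiagonals, after removal of that column.
  Ψ-column : ∀ t y e j m →
    Ψ (suc t) (suc y) e j m
      ≡ Ψ t (suc y) e j m + shift (suc t) (Ψ (2 ℕ.+ t) y e (j - parity (suc t))) m
  Ψ-column t y e j m = begin
    Ψ (suc t) (suc y) e j m
      ≡⟨ Ψ-body (suc t) (suc y) e j m ⟩
    shift (suc y) (body (suc t) (suc y) e i) m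
      ≡⟨ shift-cong (suc y) (body-column t y e i) m ⟩
    shift (suc y) (λ n → body t (suc y) e i n + shift t (body (2 ℕ.+ t) y e (i - parity t)) n) m
      ≡⟨ shift-+ (suc y) _ _ m ⟩
    shift (suc y) (body t (suc y) e i) m
      + shift (suc y) (shift t (body (2 ℕ.+ t) y e (i - parity t))) m
      ≡⟨ cong₂ _+_ (sym (Ψ-body t (suc y) e j m)) column ⟩
    Ψ t (suc y) e j m + shift (suc t) (Ψ (2 ℕ.+ t) y e (j - parity (suc t))) m ∎
    where
    i : ℤ
    i = + suc y - j

    target : ∀ y j ε → (+ 1 + y) - j - ε ≡ y - (j - (+ 1 - ε))
    target = solve-∀

    column : shift (suc y) (shift t (body (2 ℕ.+ t) y e (i - parity t))) m
               ≡ shift (suc t) (Ψ (2 ℕ.+ t) y e (j - parity (suc t))) m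
    column = begin
      shift (suc y) (shift t (body (2 ℕ.+ t) y e (i - parity t))) m
        ≡⟨ shift-shift (suc y) t _ m ⟩
      shift (suc y ℕ.+ t) (body (2 ℕ.+ t) y e (i - parity t)) m
        ≡⟨ cong₂ (λ s k → shift s (body (2 ℕ.+ t) y e k) m)
             (cong suc (ℕ.+-comm y t)) (target (+ y) j (parity t)) ⟩
      shift (suc t ℕ.+ y) (body (2 ℕ.+ t) y e (+ y - (j - parity (suc t)))) m
        ≡⟨ shift-shift (suc t) y _ m ⟨
      shift (suc t) (shift y (body (2 ℕ.+ t) y e (+ y - (j - parity (suc t))))) m
        ≡⟨ shift-cong (suc t) (Ψ-body (2 ℕ.+ t) y e (j - parity (suc t))) m ⟨
      shift (suc t) (Ψ (2 ℕ.+ t) y e (j - parity (suc t))) m ∎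

  body-column : ∀ t y e i m →
    body (suc t) (suc y) e i m
      ≡ body t (suc y) e i m + shift t (body (2 ℕ.+ t) y e (i - parity t)) m
  body-column zero y e i m =
    trans (body-column-1 y e i m)
          (cong (λ k → body 0 (suc y) e i m + body 2 y e k m) (sym (ℤ.+-identityʳ i)))
  body-column (suc t) y e i m = begin
    F 0 + antiSum (suc y) (λ p g → + multichoose e g * Ψ (suc t) (suc p) g i m)
      -- With no boxes and an empty position at hand, `Ψ` is `δ` for every bound, so the term
      -- `p = 0` does not see the change from `suc t` to `t`.
      ≡⟨⟩
    F′ 0 + antiSum (suc y) (λ p g → + multichoose e g * Ψ (suc t) (suc p) g i m)
      ≡⟨ +-congˡ (F′ 0) (antiSum-cong (suc y) λ p g _ →
           trans (cong (+ multichoose e g *_) (Ψ-column t p g i m))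
                 (ℤ.*-distribˡ-+ (+ multichoose e g) (Ψ t (suc p) g i m) (D p g))) ⟩
    F′ 0 + antiSum (suc y) (λ p g →
      + multichoose e g * Ψ t (suc p) g i m
        + + multichoose e g * D p g)
      ≡⟨ +-congˡ (F′ 0) (antiSum-+ (suc y) (λ p g → + multichoose e g * Ψ t (suc p) g i m)
                                          (λ p g → + multichoose e g * D p g)) ⟩
    F′ 0 + (antiSum (suc y) (λ p g → + multichoose e g * Ψ t (suc p) g i m) + column)
      ≡⟨ ℤ.+-assoc (F′ 0) (antiSum (suc y) (λ p g → + multichoose e g * Ψ t (suc p) g i m)) column ⟨
    body (suc t) (suc y) e i m + column
      ≡⟨ +-congˡ (body (suc t) (suc y) e i m) column-shift ⟩
    body (suc t) (suc y) e i m
      + shift (suc t) (body (3 ℕ.+ t) y e (i - parity (suc t))) m ∎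
    where
    F F′ : ℕ → ℤ
    F p = + multichoose e (2 ℕ.+ y) * Ψ (suc t) p (2 ℕ.+ y) i m
    F′ p = + multichoose e (2 ℕ.+ y) * Ψ t p (2 ℕ.+ y) i m
    D : ℕ → ℕ → ℤ
    D p g = shift (suc t) (Ψ (2 ℕ.+ t) p g (i - parity (suc t))) m
    column : ℤ
    column = antiSum (suc y) (λ p g → + multichoose e g * D p g)
    column-shift :
      column ≡ shift (suc t) (body (3 ℕ.+ t) y e (i - parity (suc t))) m
    column-shift =
      trans (antiSum-cong (suc y) λ p g _ →
               shift-*ˡ (suc t) (+ multichoose e g) (Ψ (2 ℕ.+ t) p g (i - parity (suc t))) m)
            (shift-antiSum (suc t) (suc y)
               (λ p g n → + multichoose e g * Ψ (2 ℕ.+ t) p g (i - parity (suc t)) n) m)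

-- Young diagrams with at most `a` rows

R : ℕ → ℤ → Series
R a j m = δ j m + Ψ a 1 0 j m

R-zero : ∀ j → R 0 j ≐ δ j
R-zero j m = trans (+-congˡ (δ j m) (Ψ-0-0 1 j m)) (ℤ.+-identityʳ (δ j m))

-- Removing a first column of exactly `suc a` boxes moves every other box one antidiagonal back,
-- which reverses its sign; what remains still has at most `suc a` rows.
R-suc : ∀ a j m →
  R (suc a) j m ≡ R a j m + shift (suc a) (R (suc a) (parity (suc a) - j)) m
R-suc a j m = begin
  δ j m + Ψ (suc a) 1 0 j m
    ≡⟨ +-congˡ (δ j m) (Ψ-column a 0 0 j m) ⟩
  δ j m + (Ψ a 1 0 j m + shift (suc a) (Ψ (2 ℕ.+ a) 0 0 (j - parity (suc a))) m)
    ≡⟨ ℤ.+-assoc (δ j m) (Ψ a 1 0 j m) (shift (suc a) (Ψ (2 ℕ.+ a) 0 0 (j - parity (suc a))) m) ⟨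
  R a j m + shift (suc a) (Ψ (2 ℕ.+ a) 0 0 (j - parity (suc a))) m
    ≡⟨ +-congˡ (R a j m) (shift-cong (suc a) flipped m) ⟩
  R a j m + shift (suc a) (R (suc a) (parity (suc a) - j)) m ∎
  where
  negate : ∀ j ε → + 0 - (j - ε) ≡ ε - j
  negate = solve-∀
  -- The removed column leaves an empty antidiagonal in front. Unfolding `Ψ` there uses up one unit
  -- of the bound `2 + a` and yields the two terms of `R`.
  flipped : Ψ (2 ℕ.+ a) 0 0 (j - parity (suc a)) ≐ R (suc a) (parity (suc a) - j)
  flipped n =
    trans (ℤ.+-comm (Ψ (suc a) 1 0 (+ 0 - (j - parity (suc a))) n)
                    (δ (+ 0 - (j - parity (suc a))) n))
          (cong (λ k → R (suc a) k n) (negate j (parity (suc a))))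

-- The left-hand side as a sum over antidiagonal counts

sumOver : {A : Set} → List A → (A → ℤ) → ℤ
sumOver xs f = sumℤ (map f xs)

sumTo : ℕ → (ℕ → ℤ) → ℤ
sumTo N f = sumℤ (applyUpTo f N)

sumℤ-++ : ∀ xs ys → sumℤ (xs ++ ys) ≡ sumℤ xs + sumℤ ys
sumℤ-++ [] ys = sym (ℤ.+-identityˡ (sumℤ ys))
sumℤ-++ (x ∷ xs) ys =
  trans (+-congˡ x (sumℤ-++ xs ys)) (sym (ℤ.+-assoc x (sumℤ xs) (sumℤ ys)))

sumOver-cong : {A : Set} (xs : List A) {f g : A → ℤ} →
               (∀ x → f x ≡ g x) → sumOver xs f ≡ sumOver xs g
sumOver-cong xs eq = cong sumℤ (List.map-cong eq xs)

sumOver-0 : {A : Set} (xs : List A) → sumOver xs (λ _ → + 0) ≡ + 0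
sumOver-0 [] = refl
sumOver-0 (x ∷ xs) = trans (ℤ.+-identityˡ (sumOver xs (λ _ → + 0))) (sumOver-0 xs)

sumOver-if : {A : Set} (xs : List A) (b : Bool) (f : A → ℤ) →
  sumOver xs (λ x → if b then f x else + 0) ≡ (if b then sumOver xs f else + 0)
sumOver-if xs false f = sumOver-0 xs
sumOver-if xs true f = refl

sumOver-map : {A B : Set} (h : A → B) (xs : List A) (f : B → ℤ) →
  sumOver (map h xs) f ≡ sumOver xs (λ x → f (h x))
sumOver-map h xs f = cong sumℤ (sym (List.map-∘ xs))

sumOver-concatMap : {A B : Set} (h : A → List B) (xs : List A) (f : B → ℤ) →
  sumOver (concatMap h xs) f ≡ sumOver xs (λ x → sumOver (h x) f)
sumOver-concatMap h [] f = refl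
sumOver-concatMap h (x ∷ xs) f = begin
  sumℤ (map f (h x ++ concatMap h xs))
    ≡⟨ cong sumℤ (List.map-++ f (h x) (concatMap h xs)) ⟩
  sumℤ (map f (h x) ++ map f (concatMap h xs))
    ≡⟨ sumℤ-++ (map f (h x)) (map f (concatMap h xs)) ⟩
  sumOver (h x) f + sumOver (concatMap h xs) f
    ≡⟨ +-congˡ (sumOver (h x) f) (sumOver-concatMap h xs f) ⟩
  sumOver (h x) f + sumOver xs (λ x → sumOver (h x) f) ∎

sumOver-filter : {A : Set} (P : A → Bool) (xs : List A) (f : A → ℤ) →
  sumOver (filterᵇ P xs) f ≡ sumOver xs (λ x → if P x then f x else + 0)
sumOver-filter P [] f = refl
sumOver-filter P (x ∷ xs) f with P x
... | true = +-congˡ (f x) (sumOver-filter P xs f)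
... | false = trans (sumOver-filter P xs f)
                    (sym (ℤ.+-identityˡ (sumOver xs (λ x → if P x then f x else + 0))))

sumOver-upTo : ∀ N f → sumOver (upTo N) f ≡ sumTo N f
sumOver-upTo N f = cong sumℤ (List.map-upTo f N)

sumOver-range1 : ∀ N f → sumOver (range1 N) f ≡ sumTo N (λ k → f (suc k))
sumOver-range1 N f = trans (sumOver-map suc (upTo N) f) (sumOver-upTo N (λ k → f (suc k)))

sumTo-cong : ∀ N {f g} → (∀ k → k ℕ.< N → f k ≡ g k) → sumTo N f ≡ sumTo N g
sumTo-cong zero eq = refl
sumTo-cong (suc N) eq =
  cong₂ _+_ (eq 0 (s≤s z≤n)) (sumTo-cong N (λ k k<N → eq (suc k) (s≤s k<N)))

sumTo-0 : ∀ N → sumTo N (λ _ → + 0) ≡ + 0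
sumTo-0 zero = refl
sumTo-0 (suc N) = trans (ℤ.+-identityˡ (sumTo N (λ _ → + 0))) (sumTo-0 N)

sumTo-+ : ∀ N f g → sumTo N (λ k → f k + g k) ≡ sumTo N f + sumTo N g
sumTo-+ zero f g = refl
sumTo-+ (suc N) f g =
  trans (+-congˡ (f 0 + g 0) (sumTo-+ N (λ k → f (suc k)) (λ k → g (suc k))))
        (interchange (f 0) (g 0) (sumTo N (λ k → f (suc k))) (sumTo N (λ k → g (suc k))))

sumTo-antiSum : ∀ N (H : ℕ → ℕ → ℤ) → sumTo (suc N) (λ k → H k (N ∸ k)) ≡ antiSum N H
sumTo-antiSum zero H = ℤ.+-identityʳ (H 0 0)
sumTo-antiSum (suc N) H = +-congˡ (H 0 (suc N)) (sumTo-antiSum N (λ k → H (suc k)))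

sumTo-⊓-antiSum : ∀ m y (H : ℕ → Series) →
  sumTo (suc (m ⊓ y)) (λ k → H k (m ∸ k)) ≡ antiSum y (λ k _ → shift k (H k) m)
sumTo-⊓-antiSum zero zero H = ℤ.+-identityʳ (H 0 0)
sumTo-⊓-antiSum zero (suc y) H = +-congˡ (H 0 0) (sym (antiSum-0 y))
sumTo-⊓-antiSum (suc m) zero H = ℤ.+-identityʳ (H 0 (suc m))
sumTo-⊓-antiSum (suc m) (suc y) H =
  +-congˡ (H 0 (suc m)) (sumTo-⊓-antiSum m y (λ k → H (suc k)))

triangleSum : ℕ → (ℕ → ℕ → ℤ) → ℤ
triangleSum zero H = + 0
triangleSum (suc N) H = sumTo (suc N) (H 0) + triangleSum N (λ k → H (suc k))

-- Exchange of summation: partitions listed by size become partitions listed by largest part.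
sumTo-antiSum-triangle : ∀ N H → sumTo N (λ s → antiSum s H) ≡ triangleSum N H
sumTo-antiSum-triangle zero H = refl
sumTo-antiSum-triangle (suc N) H = begin
  H 0 0 + sumTo N (λ s → H 0 (suc s) + antiSum s (λ k → H (suc k)))
    ≡⟨ +-congˡ (H 0 0) (sumTo-+ N (λ s → H 0 (suc s)) (λ s → antiSum s (λ k → H (suc k)))) ⟩
  H 0 0 + (sumTo N (λ s → H 0 (suc s)) + sumTo N (λ s → antiSum s (λ k → H (suc k))))
    ≡⟨ ℤ.+-assoc (H 0 0) (sumTo N (λ s → H 0 (suc s)))
                 (sumTo N (λ s → antiSum s (λ k → H (suc k)))) ⟨
  sumTo (suc N) (H 0) + sumTo N (λ s → antiSum s (λ k → H (suc k)))
    ≡⟨ +-congˡ (sumTo (suc N) (H 0)) (sumTo-antiSum-triangle N (λ k → H (suc k))) ⟩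
  triangleSum (suc N) H ∎

shift-beyond : ∀ k f {n} → n ℕ.< k → shift k f n ≡ + 0
shift-beyond (suc k) f {zero} n<k = refl
shift-beyond (suc k) f {suc n} (s≤s n<k) = shift-beyond k f n<k

shift-cong-at : ∀ k {f g} n → (∀ r → k ℕ.+ r ≡ n → f r ≡ g r) → shift k f n ≡ shift k g n
shift-cong-at zero n eq = eq n refl
shift-cong-at (suc k) zero eq = refl
shift-cong-at (suc k) (suc n) eq = shift-cong-at k n (λ r e → eq r (cong suc e))

⌊⌋-cong : {A B : Set} (a : Dec A) (b : Dec B) → (A → B) → (B → A) → ⌊ a ⌋ ≡ ⌊ b ⌋
⌊⌋-cong (yes a) (yes b) f g = refl
⌊⌋-cong (yes a) (no ¬b) f g = contradiction (f a) ¬b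
⌊⌋-cong (no ¬a) (yes b) f g = contradiction (g b) ¬a
⌊⌋-cong (no ¬a) (no ¬b) f g = refl

⌊suc≟suc⌋ : ∀ m n → ⌊ suc m ℕ.≟ suc n ⌋ ≡ ⌊ m ℕ.≟ n ⌋
⌊suc≟suc⌋ m n = ⌊⌋-cong (suc m ℕ.≟ suc n) (m ℕ.≟ n) ℕ.suc-injective (cong suc)

-- Turns the test on the exponent in `lhs` into multiplication by `q^k`; the bound keeps any index
-- that the test selects inside the range.
sumTo-pick : ∀ k M n f → n ℕ.< k ℕ.+ M →
  sumTo M (λ r → if ⌊ k ℕ.+ r ℕ.≟ n ⌋ then f r else + 0) ≡ shift k f n
sumTo-pick (suc k) M zero f n<k+M = sumTo-0 M
sumTo-pick (suc k) M (suc n) f (s≤s n<k+M) =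
  trans (sumTo-cong M (λ r _ → cong (λ b → if b then f r else + 0) (⌊suc≟suc⌋ (k ℕ.+ r) n)))
        (sumTo-pick k M n f n<k+M)
sumTo-pick zero (suc M) zero f n<M =
  trans (+-congˡ (f 0) (sumTo-0 M)) (ℤ.+-identityʳ (f 0))
sumTo-pick zero (suc M) (suc n) f (s≤s n<M) =
  trans (ℤ.+-identityˡ (sumTo M (λ r → if ⌊ suc r ℕ.≟ suc n ⌋ then f (suc r) else + 0)))
  (trans (sumTo-cong M (λ r _ → cong (λ b → if b then f (suc r) else + 0) (⌊suc≟suc⌋ r n)))
         (sumTo-pick zero M n (λ r → f (suc r)) n<M))

-- From binomial weights to antidiagonal counts

weight-∷ : ∀ x l →
  weight (x ∷ l) ≡ ((x ∸ nth l 1 ℕ.+ 1) C (nth l 0 ∸ nth l 1)) ℕ.* weight l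
weight-∷ x l = cong (λ xs → factor₁ ℕ.* prodℕ xs) (begin
  map F (map suc (applyUpTo suc (length l)))
    ≡⟨ cong (λ xs → map F (map suc xs)) (List.map-upTo suc (length l)) ⟨
  map F (map suc (range1 (length l)))
    ≡⟨ List.map-∘ (range1 (length l)) ⟨
  map (λ i → F (suc i)) (range1 (length l))
    ≡⟨ List.map-∘ (upTo (length l)) ⟨
  map (λ i → F (suc (suc i))) (upTo (length l))
    ≡⟨ List.map-∘ (upTo (length l)) ⟩
  map (λ i → (part l i ∸ part l (suc (suc i)) ℕ.+ 1) C (part l (suc i) ∸ part l (suc (suc i))))
      (range1 (length l)) ∎)
  where
  F : ℕ → ℕ
  F i = (part (x ∷ l) i ∸ part (x ∷ l) (suc (suc i)) ℕ.+ 1)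
          C (part (x ∷ l) (suc i) ∸ part (x ∷ l) (suc (suc i)))
  factor₁ : ℕ
  factor₁ = (x ∸ nth l 1 ℕ.+ 1) C (nth l 0 ∸ nth l 1)

multichoose-C : ∀ e g → multichoose e (suc g) ≡ (e ℕ.+ g) C g
multichoose-C zero g = sym (nCn≡1 g)
multichoose-C (suc e) zero = trans (ℕ.+-identityʳ _) (multichoose-C e zero)
multichoose-C (suc e) (suc g) = begin
  multichoose e (2 ℕ.+ g) ℕ.+ multichoose (suc e) (suc g)
    ≡⟨ cong₂ ℕ._+_ (multichoose-C e (suc g)) (multichoose-C (suc e) g) ⟩
  ((e ℕ.+ suc g) C suc g) ℕ.+ ((suc e ℕ.+ g) C g)
    ≡⟨ cong (λ s → (s C suc g) ℕ.+ ((suc e ℕ.+ g) C g)) (ℕ.+-suc e g) ⟩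
  ((suc e ℕ.+ g) C suc g) ℕ.+ ((suc e ℕ.+ g) C g)
    ≡⟨ ℕ.+-comm ((suc e ℕ.+ g) C suc g) _ ⟩
  ((suc e ℕ.+ g) C g) ℕ.+ ((suc e ℕ.+ g) C suc g)
    ≡⟨ nCk+nC[k+1]≡[n+1]C[k+1] (suc e ℕ.+ g) g ⟩
  suc (suc e ℕ.+ g) C suc g
    ≡⟨ cong (λ s → suc s C suc g) (ℕ.+-suc e g) ⟨
  (suc e ℕ.+ suc g) C suc g ∎

alternating : List ℕ → ℤ
alternating [] = + 0
alternating (x ∷ l) = + x - alternating l

δ-suc : ∀ j n → δ j (suc n) ≡ + 0
δ-suc (+ zero) n = refl
δ-suc (+ suc _) n = refl
δ-suc -[1+ _ ] n = refl

δ-0 : ∀ j → (if ⌊ + 0 ℤ.≟ j ⌋ then + 1 else + 0) ≡ δ j 0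
δ-0 (+ zero) = refl
δ-0 (+ suc _) = refl
δ-0 -[1+ _ ] = refl

sumOver-partsF-suc : ∀ f m b (F : List ℕ → ℤ) →
  sumOver (partsF (suc f) (suc m) (suc b)) F
    ≡ sumTo (suc (m ⊓ b)) (λ k → sumOver (partsF f (m ∸ k) (suc k)) (λ l → F (suc k ∷ l)))
sumOver-partsF-suc f m b F = begin
  sumOver (concatMap (λ p → map (p ∷_) (partsF f (suc m ∸ p) p)) (range1 (suc (m ⊓ b)))) F
    ≡⟨ sumOver-concatMap (λ p → map (p ∷_) (partsF f (suc m ∸ p) p)) (range1 (suc (m ⊓ b))) F ⟩
  sumOver (range1 (suc (m ⊓ b))) (λ p → sumOver (map (p ∷_) (partsF f (suc m ∸ p) p)) F)
    ≡⟨ sumOver-range1 (suc (m ⊓ b)) (λ p → sumOver (map (p ∷_) (partsF f (suc m ∸ p) p)) F) ⟩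
  sumTo (suc (m ⊓ b)) (λ k → sumOver (map (suc k ∷_) (partsF f (m ∸ k) (suc k))) F)
    ≡⟨ sumTo-cong (suc (m ⊓ b)) (λ k _ → sumOver-map (suc k ∷_) (partsF f (m ∸ k) (suc k)) F) ⟩
  sumTo (suc (m ⊓ b)) (λ k → sumOver (partsF f (m ∸ k) (suc k)) (λ l → F (suc k ∷ l))) ∎

-- Every list in `partsF f m b` has size `m`, also when the fuel runs out and no list is produced.
-- The form with `G` allows the replacement inside a summand.
sumOver-partsF-size : ∀ f m b (G : ℕ → List ℕ → ℤ) →
  sumOver (partsF f m b) (λ l → G (size l) l) ≡ sumOver (partsF f m b) (G m)
sumOver-partsF-size f zero b G = refl
sumOver-partsF-size zero (suc m) b G = refl
sumOver-partsF-size (suc f) (suc m) zero G = refl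
sumOver-partsF-size (suc f) (suc m) (suc b) G = begin
  sumOver (partsF (suc f) (suc m) (suc b)) (λ l → G (size l) l)
    ≡⟨ sumOver-partsF-suc f m b (λ l → G (size l) l) ⟩
  sumTo (suc (m ⊓ b)) (λ k →
    sumOver (partsF f (m ∸ k) (suc k)) (λ l → G (suc k ℕ.+ size l) (suc k ∷ l)))
    ≡⟨ sumTo-cong (suc (m ⊓ b)) (λ k k< →
         trans (sumOver-partsF-size f (m ∸ k) (suc k) (λ s l → G (suc k ℕ.+ s) (suc k ∷ l)))
               (cong (λ s → sumOver (partsF f (m ∸ k) (suc k)) (λ l → G (suc s) (suc k ∷ l)))
                     (ℕ.m+[n∸m]≡n (ℕ.≤-trans (ℕ.≤-pred k<) (ℕ.m⊓n≤m m b))))) ⟩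
  sumTo (suc (m ⊓ b)) (λ k → sumOver (partsF f (m ∸ k) (suc k)) (λ l → G (suc m) (suc k ∷ l)))
    ≡⟨ sumOver-partsF-suc f m b (G (suc m)) ⟨
  sumOver (partsF (suc f) (suc m) (suc b)) (G (suc m)) ∎

minus-swap : ∀ a {b c} → a - b ≡ c → b ≡ a - c
minus-swap a {b} refl = lemma a b
  where
  lemma : ∀ a b → b ≡ a - (a - b)
  lemma = solve-∀

-- Each binomial involves three consecutive parts. Peeling off a part fixes two of them, and the
-- binomial then passes into `κ` as a function of the third. The row bound imposes nothing, because
-- `m` boxes meet at most `m ≤ t` further antidiagonals.
sumOver-partsF-Ψ : ∀ f m y t i (κ : ℕ → ℤ) → m ℕ.≤ f → m ℕ.≤ t →
  sumOver (partsF f m y)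
    (λ l → if ⌊ alternating l ℤ.≟ i ⌋ then κ (nth l 0) * + weight (y ∷ l) else + 0)
    ≡ antiSum y (λ p g → κ p * Ψ t p (suc g) i m)
sumOver-partsF-Ψ f zero y t i κ _ _ = begin
  (if ⌊ + 0 ℤ.≟ i ⌋ then κ 0 * + 1 else + 0) + + 0
    ≡⟨ ℤ.+-identityʳ (if ⌊ + 0 ℤ.≟ i ⌋ then κ 0 * + 1 else + 0) ⟩
  (if ⌊ + 0 ℤ.≟ i ⌋ then κ 0 * + 1 else + 0)
    ≡⟨ if-*ˡ ⌊ + 0 ℤ.≟ i ⌋ ⟩
  κ 0 * (if ⌊ + 0 ℤ.≟ i ⌋ then + 1 else + 0)
    ≡⟨ cong (λ d → κ 0 * d) (δ-0 i) ⟩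
  κ 0 * δ i 0
    ≡⟨ only-0 y ⟨
  antiSum y (λ p g → κ p * Ψ t p (suc g) i 0) ∎
  where
  if-*ˡ : ∀ b → (if b then κ 0 * + 1 else + 0) ≡ κ 0 * (if b then + 1 else + 0)
  if-*ˡ true = refl
  if-*ˡ false = sym (ℤ.*-zeroʳ (κ 0))
  only-0 : ∀ y → antiSum y (λ p g → κ p * Ψ t p (suc g) i 0) ≡ κ 0 * δ i 0
  only-0 zero = refl
  only-0 (suc y) =
    trans (+-congˡ (κ 0 * δ i 0)
             (trans (antiSum-cong y (λ p g _ → ℤ.*-zeroʳ (κ (suc p)))) (antiSum-0 y)))
          (ℤ.+-identityʳ (κ 0 * δ i 0))
sumOver-partsF-Ψ (suc f) (suc m) zero (suc t) i κ _ _ =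
  sym (trans (cong (λ d → κ 0 * d) (δ-suc i m)) (ℤ.*-zeroʳ (κ 0)))
sumOver-partsF-Ψ (suc f) (suc m) (suc y) (suc t) i κ (s≤s m≤f) (s≤s m≤t) = begin
  sumOver (partsF (suc f) (suc m) (suc y)) T
    ≡⟨ sumOver-partsF-suc f m y T ⟩
  sumTo (suc (m ⊓ y)) (λ k → sumOver (partsF f (m ∸ k) (suc k)) (λ l → T (suc k ∷ l)))
    ≡⟨ sumTo-cong (suc (m ⊓ y)) (λ k _ →
         trans (sumOver-cong (partsF f (m ∸ k) (suc k)) (peel k))
               (sumOver-partsF-Ψ f (m ∸ k) (suc k) t (+ suc k - i) (κ′ k)
                  (ℕ.≤-trans (ℕ.m∸n≤m m k) m≤f) (ℕ.≤-trans (ℕ.m∸n≤m m k) m≤t))) ⟩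
  sumTo (suc (m ⊓ y)) (λ k → H k (m ∸ k))
    ≡⟨ sumTo-⊓-antiSum m y H ⟩
  antiSum y (λ k _ → shift k (H k) m)
    ≡⟨ antiSum-cong y level ⟩
  antiSum y (λ k g → κ (suc k) * Ψ (suc t) (suc k) (suc g) i (suc m))
    ≡⟨ ℤ.+-identityˡ (antiSum y (λ k g → κ (suc k) * Ψ (suc t) (suc k) (suc g) i (suc m))) ⟨
  + 0 + antiSum y (λ k g → κ (suc k) * Ψ (suc t) (suc k) (suc g) i (suc m))
    ≡⟨ cong (λ d → d + antiSum y (λ k g → κ (suc k) * Ψ (suc t) (suc k) (suc g) i (suc m)))
         (trans (cong (λ d → κ 0 * d) (δ-suc i m)) (ℤ.*-zeroʳ (κ 0))) ⟨
  antiSum (suc y) (λ p g → κ p * Ψ (suc t) p (suc g) i (suc m)) ∎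
  where
  T : List ℕ → ℤ
  T l = if ⌊ alternating l ℤ.≟ i ⌋ then κ (nth l 0) * + weight (suc y ∷ l) else + 0

  κ′ : ℕ → ℕ → ℤ
  κ′ k q = κ (suc k) * + ((suc y ∸ q ℕ.+ 1) C (suc k ∸ q))

  H : ℕ → Series
  H k r = antiSum (suc k) (λ q g → κ′ k q * Ψ t q (suc g) (+ suc k - i) r)

  peel : ∀ k l → T (suc k ∷ l)
    ≡ (if ⌊ alternating l ℤ.≟ + suc k - i ⌋ then κ′ k (nth l 0) * + weight (suc k ∷ l) else + 0)
  peel k l = cong₂ (λ b v → if b then v else + 0)
    (⌊⌋-cong (+ suc k - alternating l ℤ.≟ i) (alternating l ℤ.≟ + suc k - i)
       (minus-swap (+ suc k)) (λ e → sym (minus-swap (+ suc k) (sym e))))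
    (begin
      κ (suc k) * + weight (suc y ∷ suc k ∷ l)
        ≡⟨ cong (λ w → κ (suc k) * + w) (weight-∷ (suc y) (suc k ∷ l)) ⟩
      κ (suc k) * + (c ℕ.* weight (suc k ∷ l))
        ≡⟨ cong (λ w → κ (suc k) * w) (ℤ.pos-* c (weight (suc k ∷ l))) ⟩
      κ (suc k) * (+ c * + weight (suc k ∷ l))
        ≡⟨ ℤ.*-assoc (κ (suc k)) (+ c) (+ weight (suc k ∷ l)) ⟨
      κ′ k (nth l 0) * + weight (suc k ∷ l) ∎)
    where
    c : ℕ
    c = (suc y ∸ nth l 0 ℕ.+ 1) C (suc k ∸ nth l 0)

  binomial : ∀ k g q h → k ℕ.+ g ≡ y → q ℕ.+ h ≡ suc k →
    (suc y ∸ q ℕ.+ 1) C (suc k ∸ q) ≡ multichoose (suc g) (suc h)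
  binomial k g q h refl e rewrite sym e = begin
    (suc k ℕ.+ g ∸ q ℕ.+ 1) C (q ℕ.+ h ∸ q)
      ≡⟨ cong (λ s → (s ℕ.+ g ∸ q ℕ.+ 1) C (q ℕ.+ h ∸ q)) e ⟨
    (q ℕ.+ h ℕ.+ g ∸ q ℕ.+ 1) C (q ℕ.+ h ∸ q)
      ≡⟨ cong₂ (λ s u → (s ℕ.+ 1) C u)
           (trans (cong (_∸ q) (ℕ.+-assoc q h g)) (ℕ.m+n∸m≡n q (h ℕ.+ g)))
           (ℕ.m+n∸m≡n q h) ⟩
    (h ℕ.+ g ℕ.+ 1) C h
      ≡⟨ cong (_C h) (trans (ℕ.+-comm (h ℕ.+ g) 1) (cong suc (ℕ.+-comm h g))) ⟩
    (suc g ℕ.+ h) C h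
      ≡⟨ multichoose-C (suc g) h ⟨
    multichoose (suc g) (suc h) ∎

  H-body : ∀ k g → k ℕ.+ g ≡ y → ∀ r →
    H k r ≡ κ (suc k) * body (suc t) (suc k) (suc g) (+ suc k - i) r
  H-body k g k+g r = begin
    H k r
      ≡⟨ antiSum-cong (suc k) (λ q h q+h →
           trans (cong (λ c → κ (suc k) * + c * ψ q (suc h)) (binomial k g q h k+g q+h))
                 (ℤ.*-assoc (κ (suc k)) (+ multichoose (suc g) (suc h)) (ψ q (suc h)))) ⟩
    antiSum (suc k) (λ q h → κ (suc k) * (+ multichoose (suc g) (suc h) * ψ q (suc h)))
      ≡⟨ antiSum-*ˡ (suc k) (κ (suc k)) (λ q h → + multichoose (suc g) (suc h) * ψ q (suc h)) ⟩
    κ (suc k) * antiSum (suc k) (λ q h → + multichoose (suc g) (suc h) * ψ q (suc h))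
      -- `body` also contains `q = 2 + k`, a next antidiagonal longer than the present one; as an
      -- empty position exists, its coefficient `multichoose (suc g) 0` is `0`.
      ≡⟨ cong (λ x → κ (suc k) * x)
           (ℤ.+-identityʳ (antiSum (suc k) (λ q h → + multichoose (suc g) (suc h) * ψ q (suc h)))) ⟨
    κ (suc k) * (antiSum (suc k) (λ q h → + multichoose (suc g) (suc h) * ψ q (suc h)) + + 0)
      ≡⟨ cong (λ x → κ (suc k) * x)
           (antiSum-snoc (suc k) (λ q h → + multichoose (suc g) h * ψ q h)) ⟨
    κ (suc k) * body (suc t) (suc k) (suc g) (+ suc k - i) r ∎
    where
    ψ : ℕ → ℕ → ℤ
    ψ q h = Ψ t q h (+ suc k - i) r

  level : ∀ k g → k ℕ.+ g ≡ y →
    shift k (H k) m ≡ κ (suc k) * Ψ (suc t) (suc k) (suc g) i (suc m)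
  level k g k+g = begin
    shift k (H k) m
      ≡⟨ shift-cong k (H-body k g k+g) m ⟩
    shift k (λ r → κ (suc k) * body (suc t) (suc k) (suc g) (+ suc k - i) r) m
      ≡⟨ shift-*ˡ k (κ (suc k)) (body (suc t) (suc k) (suc g) (+ suc k - i)) m ⟨
    κ (suc k) * shift k (body (suc t) (suc k) (suc g) (+ suc k - i)) m
      ≡⟨ cong (λ x → κ (suc k) * x) (Ψ-body (suc t) (suc k) (suc g) i (suc m)) ⟨
    κ (suc k) * Ψ (suc t) (suc k) (suc g) i (suc m) ∎

-- The initial entries 1, ..., p of the alternating sum

range1-snoc : ∀ N → range1 (suc N) ≡ range1 N ++ suc N ∷ []
range1-snoc N =
  trans (cong (map suc) (sym (List.upTo-∷ʳ N))) (List.map-++ suc (upTo N) (N ∷ []))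

staircase : ℕ → ℤ
staircase p = sumℤ (map (λ i → sgn (i ∸ 1) * + i) (range1 p))

staircase-suc : ∀ p → staircase (suc p) ≡ staircase p + sgn p * + suc p
staircase-suc p = begin
  sumℤ (map F (range1 (suc p)))
    ≡⟨ cong (λ xs → sumℤ (map F xs)) (range1-snoc p) ⟩
  sumℤ (map F (range1 p ++ suc p ∷ []))
    ≡⟨ cong sumℤ (List.map-++ F (range1 p) (suc p ∷ [])) ⟩
  sumℤ (map F (range1 p) ++ F (suc p) ∷ [])
    ≡⟨ sumℤ-++ (map F (range1 p)) (F (suc p) ∷ []) ⟩
  staircase p + (F (suc p) + + 0)
    ≡⟨ +-congˡ (staircase p) (ℤ.+-identityʳ (F (suc p))) ⟩
  staircase p + sgn p * + suc p ∎
  where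
  F : ℕ → ℤ
  F i = sgn (i ∸ 1) * + i

signed-sum : ∀ p l → sumTo (length l) (λ k → sgn (p ℕ.+ k) * + nth l k) ≡ sgn p * alternating l
signed-sum p [] = sym (ℤ.*-zeroʳ (sgn p))
signed-sum p (x ∷ l) = begin
  sgn (p ℕ.+ 0) * + x + sumTo (length l) (λ k → sgn (p ℕ.+ suc k) * + nth l k)
    ≡⟨ cong₂ (λ q s → sgn q * + x + s) (ℕ.+-identityʳ p)
         (sumTo-cong (length l) (λ k _ → cong (λ q → sgn q * + nth l k) (ℕ.+-suc p k))) ⟩
  sgn p * + x + sumTo (length l) (λ k → sgn (suc p ℕ.+ k) * + nth l k)
    ≡⟨ +-congˡ (sgn p * + x) (signed-sum (suc p) l) ⟩
  sgn p * + x + - sgn p * alternating l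
    ≡⟨ factor-out (sgn p) (+ x) (alternating l) ⟩
  sgn p * (+ x - alternating l) ∎
  where
  factor-out : ∀ s x a → s * x + - s * a ≡ s * (x - a)
  factor-out = solve-∀

altSum-∷ : ∀ p l → altSum (p ∷ l) ≡ staircase p + sgn p * alternating l
altSum-∷ p l = +-congˡ (staircase p) (begin
  sumOver (map (2 ℕ.+_) (upTo (length l))) (λ i → sgn ((p ℕ.+ i) ∸ 2) * + part (p ∷ l) i)
    ≡⟨ sumOver-map (2 ℕ.+_) (upTo (length l)) (λ i → sgn ((p ℕ.+ i) ∸ 2) * + part (p ∷ l) i) ⟩
  sumOver (upTo (length l)) (λ k → sgn ((p ℕ.+ (2 ℕ.+ k)) ∸ 2) * + nth l k)
    ≡⟨ sumOver-upTo (length l) (λ k → sgn ((p ℕ.+ (2 ℕ.+ k)) ∸ 2) * + nth l k) ⟩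
  sumTo (length l) (λ k → sgn ((p ℕ.+ (2 ℕ.+ k)) ∸ 2) * + nth l k)
    ≡⟨ sumTo-cong (length l) (λ k _ → cong (λ q → sgn (q ∸ 2) * + nth l k)
         (trans (ℕ.+-suc p (suc k)) (cong suc (ℕ.+-suc p k)))) ⟩
  sumTo (length l) (λ k → sgn (p ℕ.+ k) * + nth l k)
    ≡⟨ signed-sum p l ⟩
  sgn p * alternating l ∎)

-- The alternating sum still to be realised after the initial entries 1, …, p.
target : ℤ → ℕ → ℤ
target j zero = j
target j (suc p) = + suc p - target j p

sgn² : ∀ p → sgn p * sgn p ≡ + 1
sgn² zero = refl
sgn² (suc p) = trans (negate² (sgn p)) (sgn² p)
  where
  negate² : ∀ s → - s * - s ≡ s * s
  negate² = solve-∀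

target-staircase : ∀ j p → target j p ≡ sgn p * (j - staircase p)
target-staircase j zero = lemma j
  where
  lemma : ∀ j → j ≡ + 1 * (j - + 0)
  lemma = solve-∀
target-staircase j (suc p) = begin
  + suc p - target j p
    ≡⟨ cong (λ x → + suc p - x) (target-staircase j p) ⟩
  + suc p - sgn p * (j - staircase p)
    ≡⟨ cong (λ x → x - sgn p * (j - staircase p)) (ℤ.*-identityˡ (+ suc p)) ⟨
  + 1 * + suc p - sgn p * (j - staircase p)
    ≡⟨ cong (λ x → x * + suc p - sgn p * (j - staircase p)) (sgn² p) ⟨
  sgn p * sgn p * + suc p - sgn p * (j - staircase p)
    ≡⟨ lemma (sgn p) (+ suc p) j (staircase p) ⟩
  - sgn p * (j - (staircase p + sgn p * + suc p))
    ≡⟨ cong (λ x → - sgn p * (j - x)) (staircase-suc p) ⟨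
  - sgn p * (j - staircase (suc p)) ∎
  where
  lemma : ∀ s q j x → s * s * q - s * (j - x) ≡ - s * (j - (x + s * q))
  lemma = solve-∀

-- Since `sgn p` is its own inverse, the equation for `altSum (p ∷ l)` can be solved for
-- `alternating l`.
⌊altSum⌋ : ∀ j p l → ⌊ altSum (p ∷ l) ℤ.≟ j ⌋ ≡ ⌊ alternating l ℤ.≟ target j p ⌋
⌊altSum⌋ j p l = ⌊⌋-cong (altSum (p ∷ l) ℤ.≟ j) (alternating l ℤ.≟ target j p) to from
  where
  s x a : ℤ
  s = sgn p
  x = staircase p
  a = alternating l
  to : altSum (p ∷ l) ≡ j → a ≡ target j p
  to refl = begin
    a                                ≡⟨ ℤ.*-identityˡ a ⟨
    + 1 * a                          ≡⟨ cong (_* a) (sgn² p) ⟨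
    s * s * a                        ≡⟨ lemma s x a ⟩
    s * (x + s * a - x)              ≡⟨ cong (λ y → s * (y - x)) (altSum-∷ p l) ⟨
    s * (altSum (p ∷ l) - x)         ≡⟨ target-staircase (altSum (p ∷ l)) p ⟨
    target (altSum (p ∷ l)) p        ∎
    where
    lemma : ∀ s x a → s * s * a ≡ s * (x + s * a - x)
    lemma = solve-∀
  from : a ≡ target j p → altSum (p ∷ l) ≡ j
  from e = begin
    altSum (p ∷ l)        ≡⟨ altSum-∷ p l ⟩
    x + s * a             ≡⟨ cong (λ y → x + s * y) (trans e (target-staircase j p)) ⟩
    x + s * (s * (j - x)) ≡⟨ lemma s x j ⟩
    x + s * s * (j - x)   ≡⟨ cong (λ y → x + y * (j - x)) (sgn² p) ⟩
    x + + 1 * (j - x)     ≡⟨ lemma′ x j ⟩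
    j                     ∎
    where
    lemma : ∀ s x j → x + s * (s * (j - x)) ≡ x + s * s * (j - x)
    lemma = solve-∀
    lemma′ : ∀ x j → x + + 1 * (j - x) ≡ j
    lemma′ = solve-∀

-- Partitions with largest part p, by the size of the remaining parts.
withLargestPart : ℤ → ℕ → Series
withLargestPart j p r = antiSum p (λ q g → + 1 * Ψ r q (suc g) (target j p) r)

sumOver-partsF-largest : ∀ f m p t j → m ℕ.≤ f → m ℕ.≤ t →
  sumOver (partsF f m p)
    (λ l → if ⌊ alternating l ℤ.≟ target j p ⌋ then + weight (p ∷ l) else + 0)
    ≡ antiSum p (λ q g → + 1 * Ψ t q (suc g) (target j p) m)
sumOver-partsF-largest f m p t j m≤f m≤t =
  trans (sumOver-cong (partsF f m p) (λ l →
           cong (λ v → if ⌊ alternating l ℤ.≟ target j p ⌋ then v else + 0)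
                (sym (ℤ.*-identityˡ (+ weight (p ∷ l))))))
        (sumOver-partsF-Ψ f m p t (target j p) (λ _ → + 1) m≤f m≤t)

-- Both bounds `r` and `t` compute the same sum over the partitions of `r` with parts at most `p`.
withLargestPart-Ψ : ∀ j p {t r} → r ℕ.≤ t →
  withLargestPart j p r ≡ antiSum p (λ q g → + 1 * Ψ t q (suc g) (target j p) r)
withLargestPart-Ψ j p {t} {r} r≤t =
  trans (sym (sumOver-partsF-largest r r p r j ℕ.≤-refl ℕ.≤-refl))
        (sumOver-partsF-largest r r p t j ℕ.≤-refl r≤t)

term : ℤ → ℕ → ℕ → ℕ → ℤ
term j n p r = if ⌊ (p C 2) ℕ.+ p ℕ.+ r ℕ.≟ n ⌋ then withLargestPart j p r else + 0

suc-C-2 : ∀ p → (p C 2) ℕ.+ p ≡ suc p C 2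
suc-C-2 p = begin
  (p C 2) ℕ.+ p       ≡⟨ ℕ.+-comm (p C 2) p ⟩
  p ℕ.+ (p C 2)       ≡⟨ cong (ℕ._+ (p C 2)) (nC1≡n p) ⟨
  (p C 1) ℕ.+ (p C 2) ≡⟨ nCk+nC[k+1]≡[n+1]C[k+1] p 1 ⟩
  suc p C 2           ∎

-- The largest parts exceeding `p` correspond to diagrams whose first `suc p` antidiagonals are
-- full. Either the next antidiagonal is full as well, which is the inductive case, or the full ones
-- end here and the largest part is `suc p`.
triangleSum-Ψ : ∀ N p t j n (H : ℕ → ℕ → ℤ) → (∀ k r → H k r ≡ term j n (suc (p ℕ.+ k)) r) →
  p ℕ.+ N ≡ n → N ℕ.≤ t →
  triangleSum N H ≡ shift (suc p C 2) (Ψ t (suc p) 0 (target j p)) n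
triangleSum-Ψ zero p t j n H eq p+N _ = sym (begin
  shift (suc p C 2) (Ψ t (suc p) 0 (target j p)) n
    ≡⟨ shift-cong (suc p C 2) (Ψ-body t (suc p) 0 (target j p)) n ⟩
  shift (suc p C 2) (shift (suc p) (body t (suc p) 0 (target j (suc p)))) n
    ≡⟨ shift-shift (suc p C 2) (suc p) (body t (suc p) 0 (target j (suc p))) n ⟩
  shift ((suc p C 2) ℕ.+ suc p) (body t (suc p) 0 (target j (suc p))) n
    -- The shift is at least `suc p`, which exceeds `n = p`.
    ≡⟨ shift-beyond ((suc p C 2) ℕ.+ suc p) (body t (suc p) 0 (target j (suc p)))
         (ℕ.≤-trans (s≤s (ℕ.≤-reflexive (trans (sym p+N) (ℕ.+-identityʳ p))))
                    (ℕ.m≤n+m (suc p) (suc p C 2))) ⟩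
  + 0 ∎)
triangleSum-Ψ (suc N) p (suc t) j n H eq p+N (s≤s N≤t) = begin
  sumTo (suc N) (H 0) + triangleSum N (λ k → H (suc k))
    ≡⟨ cong₂ _+_ firstRow
         (triangleSum-Ψ N (suc p) t j n (λ k → H (suc k))
            (λ k r → trans (eq (suc k) r) (cong (λ q → term j n (suc q) r) (ℕ.+-suc p k)))
            (trans (sym (ℕ.+-suc p N)) p+N) N≤t) ⟩
  shift K A n + shift (suc (suc p) C 2) B n
    ≡⟨ cong (λ k → shift K A n + shift k B n) (suc-C-2 (suc p)) ⟨
  shift K A n + shift K B n
    ≡⟨ shift-+ K A B n ⟨
  shift K (λ r → A r + B r) n
    ≡⟨ shift-cong-at K n (λ r e → unfold r (small r e)) ⟩
  shift K (body (suc t) (suc p) 0 (target j (suc p))) n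
    ≡⟨ shift-shift (suc p C 2) (suc p) (body (suc t) (suc p) 0 (target j (suc p))) n ⟨
  shift (suc p C 2) (shift (suc p) (body (suc t) (suc p) 0 (target j (suc p)))) n
    ≡⟨ shift-cong (suc p C 2) (Ψ-body (suc t) (suc p) 0 (target j p)) n ⟨
  shift (suc p C 2) (Ψ (suc t) (suc p) 0 (target j p)) n ∎
  where
  K : ℕ
  K = (suc p C 2) ℕ.+ suc p
  A B : Series
  A = withLargestPart j (suc p)
  B = Ψ t (suc (suc p)) 0 (target j (suc p))

  firstRow : sumTo (suc N) (H 0) ≡ shift K A n
  firstRow =
    trans (sumTo-cong (suc N) (λ r _ →
             trans (eq 0 r) (cong (λ q → term j n (suc q) r) (ℕ.+-identityʳ p))))
          (sumTo-pick K (suc N) n A n<)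
    where
    n< : n ℕ.< K ℕ.+ suc N
    n< = ℕ.≤-trans (s≤s (ℕ.≤-reflexive (sym p+N)))
                   (ℕ.+-monoˡ-≤ (suc N) (ℕ.m≤n+m (suc p) (suc p C 2)))

  small : ∀ r → K ℕ.+ r ≡ n → r ℕ.≤ t
  small r e = ℕ.≤-trans (ℕ.+-cancelˡ-≤ (suc p) r N
    (ℕ.≤-trans (ℕ.+-monoˡ-≤ r (ℕ.m≤n+m (suc p) (suc p C 2)))
               (ℕ.≤-reflexive (trans e (trans (sym p+N) (ℕ.+-suc p N)))))) N≤t

  unfold : ∀ r → r ℕ.≤ t → A r + B r ≡ body (suc t) (suc p) 0 (target j (suc p)) r
  unfold r r≤t = begin
    A r + B r
      ≡⟨ cong₂ _+_ (withLargestPart-Ψ j (suc p) r≤t) (sym (ℤ.*-identityˡ (B r))) ⟩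
    antiSum (suc p) (λ q g → + 1 * Ψ t q (suc g) (target j (suc p)) r) + + 1 * B r
      ≡⟨ antiSum-snoc (suc p) (λ q g → + 1 * Ψ t q g (target j (suc p)) r) ⟨
    body (suc t) (suc p) 0 (target j (suc p)) r ∎

if-∧ : ∀ a b (v : ℤ) → (if a ∧ b then v else + 0) ≡ (if b then (if a then v else + 0) else + 0)
if-∧ true b v = refl
if-∧ false true v = refl
if-∧ false false v = refl

-- A diagram with `n` boxes has at most `n` rows, so for `n ≤ a` the restriction is vacuous in
-- degree `n`.
lhs-R : ∀ j n a → n ℕ.≤ a → lhs j n ≡ R a j n
lhs-R j n a n≤a = begin
  lhs j n
    ≡⟨ sumOver-filter P (concatMap partitions (upTo (suc n))) (λ l → + weight l) ⟩
  sumOver (concatMap partitions (upTo (suc n))) T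
    ≡⟨ sumOver-concatMap partitions (upTo (suc n)) T ⟩
  sumOver (upTo (suc n)) (λ s → sumOver (partitions s) T)
    ≡⟨ sumOver-upTo (suc n) (λ s → sumOver (partitions s) T) ⟩
  (T [] + + 0) + sumTo n (λ s → sumOver (partitions (suc s)) T)
    ≡⟨ cong₂ _+_ (trans (ℤ.+-identityʳ (T [])) (empty j n)) (sumTo-cong n (λ s _ → ofSize s)) ⟩
  δ j n + sumTo n (λ s → antiSum s (λ k → term j n (suc k)))
    ≡⟨ +-congˡ (δ j n) (sumTo-antiSum-triangle n (λ k → term j n (suc k))) ⟩
  δ j n + triangleSum n (λ k → term j n (suc k))
    -- At `p = 0` the shift `1 C 2` is `0` and `target j 0` is `j`, which leaves the second term of
    -- `R`.
    ≡⟨ +-congˡ (δ j n)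
         (triangleSum-Ψ n 0 a j n (λ k → term j n (suc k)) (λ _ _ → refl) refl n≤a) ⟩
  R a j n ∎
  where
  P : List ℕ → Bool
  P l = ⌊ altSum l ℤ.≟ j ⌋ ∧ ⌊ (part l 1 C 2) ℕ.+ size l ℕ.≟ n ⌋
  T : List ℕ → ℤ
  T l = if P l then + weight l else + 0

  empty : ∀ j n → (if ⌊ + 0 ℤ.≟ j ⌋ ∧ ⌊ 0 ℕ.≟ n ⌋ then + 1 else + 0) ≡ δ j n
  empty (+ zero) zero = refl
  empty (+ zero) (suc n) = refl
  empty (+ suc _) n = refl
  empty -[1+ _ ] n = refl

  ofSize : ∀ s → sumOver (partitions (suc s)) T ≡ antiSum s (λ k → term j n (suc k))
  ofSize s = begin
    sumOver (partsF (suc s) (suc s) (suc s)) T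
      ≡⟨ sumOver-partsF-suc s s s T ⟩
    sumTo (suc (s ⊓ s)) (λ k → sumOver (partsF s (s ∸ k) (suc k)) (λ l → T (suc k ∷ l)))
      ≡⟨ cong (λ N → sumTo (suc N) (λ k → sumOver (partsF s (s ∸ k) (suc k)) (λ l → T (suc k ∷ l))))
           (ℕ.⊓-idem s) ⟩
    sumTo (suc s) (λ k → sumOver (partsF s (s ∸ k) (suc k)) (λ l → T (suc k ∷ l)))
      ≡⟨ sumTo-cong (suc s) (λ k _ → largest k) ⟩
    sumTo (suc s) (λ k → term j n (suc k) (s ∸ k))
      ≡⟨ sumTo-antiSum s (λ k → term j n (suc k)) ⟩
    antiSum s (λ k → term j n (suc k)) ∎
    where
    largest : ∀ k →
      sumOver (partsF s (s ∸ k) (suc k)) (λ l → T (suc k ∷ l)) ≡ term j n (suc k) (s ∸ k)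
    largest k = begin
      sumOver L (λ l → T (p ∷ l))
        ≡⟨ sumOver-cong L (λ l →
             trans (if-∧ ⌊ altSum (p ∷ l) ℤ.≟ j ⌋ ⌊ (p C 2) ℕ.+ (p ℕ.+ size l) ℕ.≟ n ⌋ (+ weight (p ∷ l)))
             (cong₂ (λ s b → if ⌊ s ℕ.≟ n ⌋ then (if b then + weight (p ∷ l) else + 0) else + 0)
                (sym (ℕ.+-assoc (p C 2) p (size l))) (⌊altSum⌋ j p l))) ⟩
      sumOver L (λ l → G (size l) l)
        ≡⟨ sumOver-partsF-size s (s ∸ k) p G ⟩
      sumOver L (G (s ∸ k))
        ≡⟨ sumOver-if L ⌊ (p C 2) ℕ.+ p ℕ.+ (s ∸ k) ℕ.≟ n ⌋
             (λ l → if ⌊ alternating l ℤ.≟ target j p ⌋ then + weight (p ∷ l) else + 0) ⟩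
      (if ⌊ (p C 2) ℕ.+ p ℕ.+ (s ∸ k) ℕ.≟ n ⌋ then
         sumOver L (λ l → if ⌊ alternating l ℤ.≟ target j p ⌋ then + weight (p ∷ l) else + 0)
       else + 0)
        ≡⟨ cong (λ v → if ⌊ (p C 2) ℕ.+ p ℕ.+ (s ∸ k) ℕ.≟ n ⌋ then v else + 0)
             (sumOver-partsF-largest s (s ∸ k) p (s ∸ k) j (ℕ.m∸n≤m s k) ℕ.≤-refl) ⟩
      term j n p (s ∸ k) ∎
      where
      p : ℕ
      p = suc k
      L : List (List ℕ)
      L = partsF s (s ∸ k) p
      G : ℕ → List ℕ → ℤ
      G r l = if ⌊ (p C 2) ℕ.+ p ℕ.+ r ℕ.≟ n ⌋ then
                (if ⌊ alternating l ℤ.≟ target j p ⌋ then + weight (p ∷ l) else + 0)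
              else + 0

-- Cancelling the product

-- Multiplication by `1 - q^k`, kept as an operator so that factors can be commuted and cancelled
-- one at a time.
Δ : ℕ → Series → Series
Δ k f n = f n - shift k f n

Δ-cong-≤ : ∀ k n {f g} → (∀ m → m ℕ.≤ n → f m ≡ g m) → ∀ m → m ℕ.≤ n → Δ k f m ≡ Δ k g m
Δ-cong-≤ k n eq m m≤n = cong₂ _-_ (eq m m≤n)
  (shift-cong-at k m (λ r e →
    eq r (ℕ.≤-trans (ℕ.≤-trans (ℕ.m≤n+m r k) (ℕ.≤-reflexive e)) m≤n)))

Δ-cong : ∀ k {f g} → f ≐ g → Δ k f ≐ Δ k g
Δ-cong k eq n = cong₂ _-_ (eq n) (shift-cong k eq n)

Δ-shift : ∀ k l f → Δ k (shift l f) ≐ shift l (Δ k f)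
Δ-shift k l f n = begin
  shift l f n - shift k (shift l f) n ≡⟨ cong (λ x → shift l f n - x) (shift-comm k l f n) ⟩
  shift l f n - shift l (shift k f) n ≡⟨ shift-minus l f (shift k f) n ⟨
  shift l (Δ k f) n                   ∎

Δ-+ : ∀ k f g → Δ k (λ n → f n + g n) ≐ (λ n → Δ k f n + Δ k g n)
Δ-+ k f g n =
  trans (cong (λ x → f n + g n - x) (shift-+ k f g n))
        (lemma (f n) (g n) (shift k f n) (shift k g n))
  where
  lemma : ∀ a b c d → a + b - (c + d) ≡ (a - c) + (b - d)
  lemma = solve-∀

Δ-minus : ∀ k f g → Δ k (λ n → f n - g n) ≐ (λ n → Δ k f n - Δ k g n)
Δ-minus k f g n =
  trans (cong (λ x → f n - g n - x) (shift-minus k f g n))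
        (lemma (f n) (g n) (shift k f n) (shift k g n))
  where
  lemma : ∀ a b c d → a - b - (c - d) ≡ (a - c) - (b - d)
  lemma = solve-∀

Δ-comm : ∀ k l f → Δ k (Δ l f) ≐ Δ l (Δ k f)
Δ-comm k l f n = begin
  Δ k (Δ l f) n                    ≡⟨ Δ-minus k f (shift l f) n ⟩
  Δ k f n - Δ k (shift l f) n      ≡⟨ cong (λ x → Δ k f n - x) (Δ-shift k l f n) ⟩
  Δ l (Δ k f) n                    ∎

Δ-zero : ∀ k → Δ k (λ _ → + 0) ≐ (λ _ → + 0)
Δ-zero k n = cong (λ x → + 0 - x) (shift-zero k n)

-- The constant term of `1 - q^(suc k)` is 1, so each coefficient is recovered from its image and an
-- earlier coefficient.
Δ-injective : ∀ k {f g} → Δ (suc k) f ≐ Δ (suc k) g → f ≐ g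
Δ-injective k {f} {g} eq n = below (suc n) n ℕ.≤-refl
  where
  restore : ∀ a b → a ≡ (a - b) + b
  restore = solve-∀
  below : ∀ N n → n ℕ.< N → f n ≡ g n
  below (suc N) n (s≤s n≤N) = begin
    f n
      ≡⟨ restore (f n) (shift (suc k) f n) ⟩
    Δ (suc k) f n + shift (suc k) f n
      ≡⟨ cong₂ _+_ (eq n) (shift-cong-at (suc k) n (λ r e → below N r
           (ℕ.≤-trans (s≤s (ℕ.m≤n+m r k)) (ℕ.≤-trans (ℕ.≤-reflexive e) n≤N)))) ⟩
    Δ (suc k) g n + shift (suc k) g n
      ≡⟨ restore (g n) (shift (suc k) g n) ⟨
    g n ∎

Δs : List ℕ → Series → Series
Δs [] f = f
Δs (k ∷ ks) f = Δ k (Δs ks f)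

Δs-cong : ∀ ks {f g} → f ≐ g → Δs ks f ≐ Δs ks g
Δs-cong [] eq = eq
Δs-cong (k ∷ ks) eq = Δ-cong k (Δs-cong ks eq)

-- Multiplication never lets a coefficient above degree `n` influence one below. This permits
-- replacing `lhs` by some `R a` with finite `a`.
Δs-cong-≤ : ∀ ks n {f g} → (∀ m → m ℕ.≤ n → f m ≡ g m) → ∀ m → m ℕ.≤ n → Δs ks f m ≡ Δs ks g m
Δs-cong-≤ [] n eq = eq
Δs-cong-≤ (k ∷ ks) n eq = Δ-cong-≤ k n (Δs-cong-≤ ks n eq)

Δs-+ : ∀ ks f g → Δs ks (λ n → f n + g n) ≐ (λ n → Δs ks f n + Δs ks g n)
Δs-+ [] f g n = refl
Δs-+ (k ∷ ks) f g n = trans (Δ-cong k (Δs-+ ks f g) n) (Δ-+ k (Δs ks f) (Δs ks g) n)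

Δs-shift : ∀ ks l f → Δs ks (shift l f) ≐ shift l (Δs ks f)
Δs-shift [] l f n = refl
Δs-shift (k ∷ ks) l f n = trans (Δ-cong k (Δs-shift ks l f) n) (Δ-shift k l (Δs ks f) n)

Δs-Δ : ∀ ks l f → Δs ks (Δ l f) ≐ Δ l (Δs ks f)
Δs-Δ [] l f n = refl
Δs-Δ (k ∷ ks) l f n = trans (Δ-cong k (Δs-Δ ks l f) n) (Δ-comm k l (Δs ks f) n)

Δs-comm : ∀ ks ls f → Δs ks (Δs ls f) ≐ Δs ls (Δs ks f)
Δs-comm [] ls f n = refl
Δs-comm (k ∷ ks) ls f n =
  trans (Δ-cong k (Δs-comm ks ls f) n) (sym (Δs-Δ ls k (Δs ks f) n))

Δs-zero : ∀ ks → Δs ks (λ _ → + 0) ≐ (λ _ → + 0)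
Δs-zero [] n = refl
Δs-zero (k ∷ ks) n = trans (Δ-cong k (Δs-zero ks) n) (Δ-zero k n)

-- Convolution with the truncated product

⊛-antiSum : ∀ f g n → (f ⊛ g) n ≡ antiSum n (λ k l → f k * g l)
⊛-antiSum f g n = trans (sumOver-upTo (suc n) (λ k → f k * g (n ∸ k)))
                        (sumTo-antiSum n (λ k l → f k * g l))

⊛-cong : ∀ {f f′ g g′} → f ≐ f′ → g ≐ g′ → f ⊛ g ≐ f′ ⊛ g′
⊛-cong eq eq′ n =
  sumOver-cong (upTo (suc n)) (λ k → cong₂ _*_ (eq k) (eq′ (n ∸ k)))

⊛-comm : ∀ f g → f ⊛ g ≐ g ⊛ f
⊛-comm f g n = begin
  (f ⊛ g) n                            ≡⟨ ⊛-antiSum f g n ⟩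
  antiSum n (λ k l → f k * g l)        ≡⟨ antiSum-cong n (λ k l _ → ℤ.*-comm (f k) (g l)) ⟩
  antiSum n (λ k l → g l * f k)        ≡⟨ antiSum-swap n (λ k l → g k * f l) ⟩
  antiSum n (λ k l → g k * f l)        ≡⟨ ⊛-antiSum g f n ⟨
  (g ⊛ f) n                            ∎

antiSum-shiftˡ : ∀ k (f g : Series) n →
  antiSum n (λ p q → shift k f p * g q) ≡ shift k (λ n → antiSum n (λ p q → f p * g q)) n
antiSum-shiftˡ zero f g n = refl
antiSum-shiftˡ (suc k) f g zero = refl
antiSum-shiftˡ (suc k) f g (suc n) =
  trans (ℤ.+-identityˡ (antiSum n (λ p q → shift k f p * g q))) (antiSum-shiftˡ k f g n)

⊛-Δˡ : ∀ k f g → Δ k f ⊛ g ≐ Δ k (f ⊛ g)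
⊛-Δˡ k f g n = begin
  (Δ k f ⊛ g) n
    ≡⟨ ⊛-antiSum (Δ k f) g n ⟩
  antiSum n (λ p q → (f p - shift k f p) * g q)
    ≡⟨ antiSum-cong n (λ p q _ → distrib (f p) (shift k f p) (g q)) ⟩
  antiSum n (λ p q → f p * g q - shift k f p * g q)
    ≡⟨ antiSum-minus n (λ p q → f p * g q) (λ p q → shift k f p * g q) ⟩
  antiSum n (λ p q → f p * g q) - antiSum n (λ p q → shift k f p * g q)
    ≡⟨ cong₂ _-_ (sym (⊛-antiSum f g n)) (trans (antiSum-shiftˡ k f g n)
         (shift-cong k (λ m → sym (⊛-antiSum f g m)) n)) ⟩
  Δ k (f ⊛ g) n ∎
  where
  distrib : ∀ a b c → (a - b) * c ≡ a * c - b * c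
  distrib = solve-∀

⊛-Δʳ : ∀ k f g → f ⊛ Δ k g ≐ Δ k (f ⊛ g)
⊛-Δʳ k f g n = begin
  (f ⊛ Δ k g) n   ≡⟨ ⊛-comm f (Δ k g) n ⟩
  (Δ k g ⊛ f) n   ≡⟨ ⊛-Δˡ k g f n ⟩
  Δ k (g ⊛ f) n   ≡⟨ Δ-cong k (⊛-comm g f) n ⟩
  Δ k (f ⊛ g) n   ∎

⊛-identityˡ : ∀ f → monomial 0 ⊛ f ≐ f
⊛-identityˡ f n = trans (⊛-antiSum (monomial 0) f n) (first n)
  where
  first : ∀ n → antiSum n (λ k l → monomial 0 k * f l) ≡ f n
  first zero = ℤ.*-identityˡ (f 0)
  first (suc n) =
    trans (cong₂ _+_ (ℤ.*-identityˡ (f (suc n))) (antiSum-0 n)) (ℤ.+-identityʳ (f (suc n)))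

⊛-identityʳ : ∀ f → f ⊛ monomial 0 ≐ f
⊛-identityʳ f n = trans (⊛-comm f (monomial 0) n) (⊛-identityˡ f n)

shift-monomial : ∀ e n → shift e (monomial 0) n ≡ monomial e n
shift-monomial zero n = refl
shift-monomial (suc e) zero = refl
shift-monomial (suc e) (suc n) =
  trans (shift-monomial e n) (cong (λ b → if b then + 1 else + 0) (sym (⌊suc≟suc⌋ n e)))

double : ℕ → ℕ
double k = k ℕ.+ k

oneMinusQ2-Δ : ∀ i → oneMinusQ2 (suc i) ≐ Δ (double (suc i)) (monomial 0)
oneMinusQ2-Δ i zero = refl
oneMinusQ2-Δ i (suc n) = begin
  (if ⌊ suc n ℕ.≟ 2 ℕ.* suc i ⌋ then - + 1 else + 0)
    ≡⟨ negate ⌊ suc n ℕ.≟ 2 ℕ.* suc i ⌋ ⟩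
  + 0 - monomial (2 ℕ.* suc i) (suc n)
    ≡⟨ cong (λ k → + 0 - monomial k (suc n)) (cong (suc i ℕ.+_) (ℕ.+-identityʳ (suc i))) ⟩
  + 0 - monomial (double (suc i)) (suc n)
    ≡⟨ cong (λ x → + 0 - x) (shift-monomial (double (suc i)) (suc n)) ⟨
  Δ (double (suc i)) (monomial 0) (suc n) ∎
  where
  negate : ∀ b → (if b then - + 1 else + 0) ≡ + 0 - (if b then + 1 else + 0)
  negate true = refl
  negate false = refl

⊛-oneMinusQ2² : ∀ i f s →
  f ⊛ (oneMinusQ2 (suc i) ⊛ oneMinusQ2 (suc i) ⊛ s) ≐ Δ (double (suc i)) (Δ (double (suc i)) (f ⊛ s))
⊛-oneMinusQ2² i f s n = begin
  (f ⊛ (o ⊛ o ⊛ s)) n       ≡⟨ ⊛-cong {f} (λ _ → refl) square n ⟩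
  (f ⊛ Δ k (Δ k s)) n       ≡⟨ ⊛-Δʳ k f (Δ k s) n ⟩
  Δ k (f ⊛ Δ k s) n         ≡⟨ Δ-cong k (⊛-Δʳ k f s) n ⟩
  Δ k (Δ k (f ⊛ s)) n       ∎
  where
  k : ℕ
  k = double (suc i)
  o : Series
  o = oneMinusQ2 (suc i)
  o⊛ : ∀ g → o ⊛ g ≐ Δ k g
  o⊛ g n = begin
    (o ⊛ g) n                    ≡⟨ ⊛-cong {g = g} (oneMinusQ2-Δ i) (λ _ → refl) n ⟩
    (Δ k (monomial 0) ⊛ g) n     ≡⟨ ⊛-Δˡ k (monomial 0) g n ⟩
    Δ k (monomial 0 ⊛ g) n       ≡⟨ Δ-cong k (⊛-identityˡ g) n ⟩
    Δ k g n                      ∎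
  square : o ⊛ o ⊛ s ≐ Δ k (Δ k s)
  square n = begin
    (o ⊛ o ⊛ s) n       ≡⟨ ⊛-cong {g = s} (o⊛ o) (λ _ → refl) n ⟩
    (Δ k o ⊛ s) n       ≡⟨ ⊛-Δˡ k o s n ⟩
    Δ k (o ⊛ s) n       ≡⟨ Δ-cong k (o⊛ s) n ⟩
    Δ k (Δ k s) n       ∎

-- `Δs (evens u)` is multiplication by the q-factorial (q²;q²)_u.
evens : ℕ → List ℕ
evens zero = []
evens (suc u) = double (suc u) ∷ evens u

⊛-prodTrunc : ∀ N f → f ⊛ prodTrunc N ≐ Δs (evens N) (Δs (evens N) f)
⊛-prodTrunc N f n = begin
  (f ⊛ prodTrunc N) n
    ≡⟨ product N (monomial 0) n ⟩
  Δs (evens N) (Δs (evens N) (f ⊛ monomial 0)) n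
    ≡⟨ Δs-cong (evens N) (Δs-cong (evens N) (⊛-identityʳ f)) n ⟩
  Δs (evens N) (Δs (evens N) f) n ∎
  where
  multiply : ℕ → Series → Series
  multiply i s = oneMinusQ2 i ⊛ oneMinusQ2 i ⊛ s
  -- The seed `s` is general because `range1 (suc N)` grows at its end, so the new factor is
  -- absorbed into the seed of `foldr`.
  product : ∀ N s → f ⊛ foldr multiply s (range1 N) ≐ Δs (evens N) (Δs (evens N) (f ⊛ s))
  product zero s n = refl
  product (suc N) s n = begin
    (f ⊛ foldr multiply s (range1 (suc N))) n
      ≡⟨ cong (λ xs → (f ⊛ foldr multiply s xs) n) (range1-snoc N) ⟩
    (f ⊛ foldr multiply s (range1 N ++ suc N ∷ [])) n
      ≡⟨ cong (λ s′ → (f ⊛ s′) n) (List.foldr-++ multiply s (range1 N) (suc N ∷ [])) ⟩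
    (f ⊛ foldr multiply (multiply (suc N) s) (range1 N)) n
      ≡⟨ product N (multiply (suc N) s) n ⟩
    Δs E (Δs E (f ⊛ multiply (suc N) s)) n
      ≡⟨ Δs-cong E (Δs-cong E (⊛-oneMinusQ2² N f s)) n ⟩
    Δs E (Δs E (Δ k (Δ k (f ⊛ s)))) n
      ≡⟨ Δs-cong E (λ m → trans (Δs-Δ E k (Δ k (f ⊛ s)) m) (Δ-cong k (Δs-Δ E k (f ⊛ s)) m)) n ⟩
    Δs E (Δ k (Δ k (Δs E (f ⊛ s)))) n
      ≡⟨ Δs-Δ E k (Δ k (Δs E (f ⊛ s))) n ⟩
    Δ k (Δs E (Δ k (Δs E (f ⊛ s)))) n ∎
    where
    E : List ℕ
    E = evens N
    k : ℕ
    k = double (suc N)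

-- The two-term recursion and reflection of the charge

R-Δ : ∀ a j → Δ (double (suc a)) (R (suc a) j)
      ≐ (λ n → R a j n + shift (suc a) (R a (parity (suc a) - j)) n)
R-Δ a j n = begin
  X n - shift (double s) X n
    ≡⟨ cong₂ _-_ (twice n) (sym (shift-shift s s X n)) ⟩
  R a j n + (shift s (R a j′) n + shift s (shift s X) n) - shift s (shift s X) n
    ≡⟨ cancel (R a j n) (shift s (R a j′) n) (shift s (shift s X) n) ⟩
  R a j n + shift s (R a j′) n ∎
  where
  s : ℕ
  s = suc a
  j′ : ℤ
  j′ = parity s - j
  X : Series
  X = R s j
  cancel : ∀ x y z → x + (y + z) - z ≡ x + y
  cancel = solve-∀
  involution : ∀ ε j → ε - (ε - j) ≡ j
  involution = solve-∀
  -- The reflection of `j` at level `s` is an involution, so the second application of `R-suc`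
  -- returns to `X` itself, shifted by `s + s` in total.
  twice : ∀ n → X n ≡ R a j n + (shift s (R a j′) n + shift s (shift s X) n)
  twice n = begin
    X n
      ≡⟨ R-suc a j n ⟩
    R a j n + shift s (R s j′) n
      ≡⟨ +-congˡ (R a j n) (shift-cong s (R-suc a j′) n) ⟩
    R a j n + shift s (λ m → R a j′ m + shift s (R s (parity s - j′)) m) n
      ≡⟨ cong (λ i → R a j n + shift s (λ m → R a j′ m + shift s (R s i) m) n) (involution (parity s) j) ⟩
    R a j n + shift s (λ m → R a j′ m + shift s X m) n
      ≡⟨ +-congˡ (R a j n) (shift-+ s (R a j′) (shift s X) n) ⟩
    R a j n + (shift s (R a j′) n + shift s (shift s X) n) ∎

-- On a two-runner abacus with a beads, charge j means that the numbers of
-- beads on the two runners differ by this much.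
difference : ℕ → ℤ → ℤ
difference zero j = + 2 * j
difference (suc a) j = + 1 - difference a j

involution₁ : ∀ x → + 1 - (+ 1 - x) ≡ x
involution₁ = solve-∀

-- `parity` and `difference` both have period two in `a`, so the cases `0` and `1` decide; the same
-- induction proves `binom2j2-flip`.
difference-flip : ∀ a j → difference a (parity a - j) ≡ - difference a j
difference-flip zero j = lemma j
  where
  lemma : ∀ j → + 2 * (+ 0 - j) ≡ - (+ 2 * j)
  lemma = solve-∀
difference-flip (suc zero) j = lemma j
  where
  lemma : ∀ j → + 1 - + 2 * (+ 1 - j) ≡ - (+ 1 - + 2 * j)
  lemma = solve-∀
difference-flip (suc (suc a)) j
  rewrite involution₁ (parity a)
        | involution₁ (difference a (parity a - j))
        | involution₁ (difference a j) = difference-flip a j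

-- Compares the exponents of the two charges that occur together in `R-Δ`.
binom2j2-flip : ∀ a j → binom2j2 (parity a - j) ≡ binom2j2 j + difference a j
binom2j2-flip zero j = lemma j
  where
  lemma : ∀ j → (+ 0 - j) * (+ 2 * (+ 0 - j) - + 1) ≡ j * (+ 2 * j - + 1) + + 2 * j
  lemma = solve-∀
binom2j2-flip (suc zero) j = lemma j
  where
  lemma : ∀ j → (+ 1 - j) * (+ 2 * (+ 1 - j) - + 1) ≡ j * (+ 2 * j - + 1) + (+ 1 - + 2 * j)
  lemma = solve-∀
binom2j2-flip (suc (suc a)) j
  rewrite involution₁ (parity a) | involution₁ (difference a j) = binom2j2-flip a j

-- The value of `binom2j2` as a natural number, so that it can serve as a shift.
exponent : ℤ → ℕ
exponent (+ zero) = 0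
exponent (+ suc k) = suc k ℕ.* suc (double k)
exponent -[1+ k ] = suc k ℕ.* suc (double (suc k))

exponent-binom2j2 : ∀ j → + exponent j ≡ binom2j2 j
exponent-binom2j2 (+ zero) = refl
exponent-binom2j2 (+ suc k) =
  trans (ℤ.pos-* (suc k) (suc (double k))) (lemma (+ k))
  where
  lemma : ∀ k → (+ 1 + k) * (+ 1 + (k + k)) ≡ (+ 1 + k) * (+ 2 * (+ 1 + k) - + 1)
  lemma = solve-∀
exponent-binom2j2 -[1+ k ] =
  trans (ℤ.pos-* (suc k) (suc (double (suc k)))) (lemma (+ k))
  where
  lemma : ∀ k → (+ 1 + k) * (+ 1 + ((+ 1 + k) + (+ 1 + k)))
              ≡ - (+ 1 + k) * (+ 2 * - (+ 1 + k) - + 1)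
  lemma = solve-∀

∣difference∣≡ : ℕ → ℤ → ℕ → Set
∣difference∣≡ a j s = difference a j ≡ + s ⊎ difference a j ≡ - + s

-- One level down, `difference` becomes `1 - difference`: for one sign its excess over the number of
-- beads is kept, for the other it grows by two.
difference-pred : ∀ a k j → ∣difference∣≡ (suc a) j (suc a ℕ.+ double (suc k)) →
  ∃[ l ] ∣difference∣≡ a j (a ℕ.+ double (suc l))
difference-pred a k j (inj₁ e) = k , inj₂ (begin
  difference a j                          ≡⟨ involution₁ (difference a j) ⟨
  + 1 - difference (suc a) j              ≡⟨ cong (λ x → + 1 - x) e ⟩
  + 1 - (+ 1 + + (a ℕ.+ double (suc k)))  ≡⟨ lemma (+ (a ℕ.+ double (suc k))) ⟩
  - + (a ℕ.+ double (suc k))              ∎)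
  where
  lemma : ∀ x → + 1 - (+ 1 + x) ≡ - x
  lemma = solve-∀
difference-pred a k j (inj₂ e) = suc k , inj₁ (begin
  difference a j                            ≡⟨ involution₁ (difference a j) ⟨
  + 1 - difference (suc a) j                ≡⟨ cong (λ x → + 1 - x) e ⟩
  + 1 - - (+ 1 + (+ a + (+ suc k + + suc k)))  ≡⟨ lemma (+ a) (+ suc k) ⟩
  + a + ((+ 1 + + suc k) + (+ 1 + + suc k)) ∎)
  where
  lemma : ∀ a k → + 1 - - (+ 1 + (a + (k + k))) ≡ a + ((+ 1 + k) + (+ 1 + k))
  lemma = solve-∀

∣difference∣-flip : ∀ a j s → ∣difference∣≡ a j s → ∣difference∣≡ a (parity a - j) s
∣difference∣-flip a j s (inj₁ e) = inj₂ (trans (difference-flip a j) (cong -_ e))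
∣difference∣-flip a j s (inj₂ e) =
  inj₁ (trans (difference-flip a j) (trans (cong -_ e) (ℤ.neg-involutive (+ s))))

-- A difference exceeding `a` in absolute value is not `u - v` for any `u + v = a`. By induction
-- both terms of `R-Δ` vanish, the reflected charge having the opposite difference; at `a = 0` the
-- charge is nonzero and `δ` is zero.
R-vanish : ∀ a k j → ∣difference∣≡ a j (a ℕ.+ double (suc k)) → R a j ≐ (λ _ → + 0)
R-vanish zero k (+ zero) (inj₁ ())
R-vanish zero k (+ zero) (inj₂ ())
R-vanish zero k (+ suc i) e n = R-zero (+ suc i) n
R-vanish zero k -[1+ i ] e n = R-zero -[1+ i ] n
R-vanish (suc a) k j e = Δ-injective (a ℕ.+ suc a) (λ n → begin
  Δ (double (suc a)) (R (suc a) j) n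
    ≡⟨ R-Δ a j n ⟩
  R a j n + shift (suc a) (R a (parity (suc a) - j)) n
    ≡⟨ cong₂ _+_ (vanish j e n)
         (trans (shift-cong (suc a)
                   (vanish (parity (suc a) - j)
                           (∣difference∣-flip (suc a) j (suc a ℕ.+ double (suc k)) e)) n)
                (shift-zero (suc a) n)) ⟩
  + 0
    ≡⟨ Δ-zero (double (suc a)) n ⟨
  Δ (double (suc a)) (λ _ → + 0) n ∎)
  where
  vanish : ∀ j → ∣difference∣≡ (suc a) j (suc a ℕ.+ double (suc k)) → R a j ≐ (λ _ → + 0)
  vanish j e with difference-pred a k j e
  ... | l , e′ = R-vanish a l j e′

-- The closed form after clearing denominators

mono : ℕ → Series
mono e = shift e (monomial 0)

clear : ℕ → ℕ → Series → Series
clear u v f = Δs (evens u) (Δs (evens v) f)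

clear-cong : ∀ u v {f g} → f ≐ g → clear u v f ≐ clear u v g
clear-cong u v eq = Δs-cong (evens u) (Δs-cong (evens v) eq)

-- The hypothesis makes the two inner exponents `2u + e` and `u + v + e′` equal, so these terms
-- cancel.
mono-telescope : ∀ u v e e′ → e′ ℕ.+ v ≡ e ℕ.+ u →
  (λ n → Δ (double u) (mono e) n + shift (u ℕ.+ v) (Δ (double v) (mono e′)) n)
    ≐ Δ (double (u ℕ.+ v)) (mono e)
mono-telescope u v e e′ eq n = begin
  (mono e n - shift (double u) (mono e) n) + shift a (Δ (double v) (mono e′)) n
    ≡⟨ +-congˡ (mono e n - shift (double u) (mono e) n)
         (shift-minus a (mono e′) (shift (double v) (mono e′)) n) ⟩
  (mono e n - shift (double u) (mono e) n)
    + (shift a (mono e′) n - shift a (shift (double v) (mono e′)) n)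
    ≡⟨ cong₂ (λ x y → (mono e n - x) + y) (shift-shift (double u) e (monomial 0) n)
         (cong₂ _-_ (trans (shift-shift a e′ (monomial 0) n) (at middle))
            (trans (shift-cong a (shift-shift (double v) e′ (monomial 0)) n)
            (trans (shift-shift a (double v ℕ.+ e′) (monomial 0) n)
            (trans (at end) (sym (shift-shift (double a) e (monomial 0) n)))))) ⟩
  (mono e n - mono (double u ℕ.+ e) n) + (mono (double u ℕ.+ e) n - shift (double a) (mono e) n)
    ≡⟨ telescope (mono e n) (mono (double u ℕ.+ e) n) (shift (double a) (mono e) n) ⟩
  Δ (double a) (mono e) n ∎
  where
  a : ℕ
  a = u ℕ.+ v
  at : ∀ {k l} → k ≡ l → mono k n ≡ mono l n
  at = cong (λ k → mono k n)
  telescope : ∀ x y z → (x - y) + (y - z) ≡ x - z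
  telescope = solve-∀
  middle : u ℕ.+ v ℕ.+ e′ ≡ u ℕ.+ u ℕ.+ e
  middle = trans (swap u v e′) (trans (cong (u ℕ.+_) eq) (swap′ u e))
    where
    swap : ∀ u v e → u ℕ.+ v ℕ.+ e ≡ u ℕ.+ (e ℕ.+ v)
    swap = ℕ-Solver.solve-∀
    swap′ : ∀ u e → u ℕ.+ (e ℕ.+ u) ≡ u ℕ.+ u ℕ.+ e
    swap′ = ℕ-Solver.solve-∀
  end : u ℕ.+ v ℕ.+ (v ℕ.+ v ℕ.+ e′) ≡ u ℕ.+ v ℕ.+ (u ℕ.+ v) ℕ.+ e
  end = trans (swap u v e′) (trans (cong (u ℕ.+ v ℕ.+ v ℕ.+_) eq) (swap′ u v e))
    where
    swap : ∀ u v e → u ℕ.+ v ℕ.+ (v ℕ.+ v ℕ.+ e) ≡ u ℕ.+ v ℕ.+ v ℕ.+ (e ℕ.+ v)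
    swap = ℕ-Solver.solve-∀
    swap′ : ∀ u v e → u ℕ.+ v ℕ.+ v ℕ.+ (e ℕ.+ u) ≡ u ℕ.+ v ℕ.+ (u ℕ.+ v) ℕ.+ e
    swap′ = ℕ-Solver.solve-∀

exponent-flip : ∀ a u v j → + u - + v ≡ difference a j →
  exponent (parity a - j) ℕ.+ v ≡ exponent j ℕ.+ u
exponent-flip a u v j e = ℤ.+-injective (begin
  + exponent (parity a - j) + + v
    ≡⟨ cong (_+ + v) (trans (exponent-binom2j2 (parity a - j)) (binom2j2-flip a j)) ⟩
  binom2j2 j + difference a j + + v
    ≡⟨ cong₂ (λ x y → x + y + + v) (exponent-binom2j2 j) e ⟨
  + exponent j + (+ u - + v) + + v
    ≡⟨ lemma (+ exponent j) (+ u) (+ v) ⟩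
  + exponent j + + u ∎)
  where
  lemma : ∀ x u v → x + (u - v) + v ≡ x + u
  lemma = solve-∀

-- After multiplication by `1 - q^(2(a+1))`, each term of `R-Δ` is known by induction up to one
-- leftover factor, `1 - q^(2u)` or `1 - q^(2v)`. These combine by `mono-telescope` to the factor
-- introduced, which `Δ-injective` cancels.
clear-R : ∀ a u v j → u ℕ.+ v ≡ a → + u - + v ≡ difference a j →
  clear u v (R a j) ≐ mono (exponent j)
clear-R zero zero zero (+ zero) _ _ n = trans (R-zero (+ 0) n) (δ-monomial n)
  where
  δ-monomial : δ (+ 0) ≐ monomial 0
  δ-monomial zero = refl
  δ-monomial (suc n) = refl
clear-R zero zero zero (+ suc _) _ ()
clear-R zero zero zero -[1+ _ ] _ ()
clear-R (suc a) u v j u+v d = Δ-injective (a ℕ.+ suc a) (λ n → begin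
  Δ k (clear u v (R (suc a) j)) n
    ≡⟨ Δs-Δ (evens u) k (Δs (evens v) (R (suc a) j)) n ⟨
  Δs (evens u) (Δ k (Δs (evens v) (R (suc a) j))) n
    ≡⟨ Δs-cong (evens u) (λ m → sym (Δs-Δ (evens v) k (R (suc a) j) m)) n ⟩
  clear u v (Δ k (R (suc a) j)) n
    ≡⟨ clear-cong u v (R-Δ a j) n ⟩
  clear u v (λ m → R a j m + shift (suc a) (R a j′) m) n
    ≡⟨ Δs-cong (evens u) (λ m → trans (Δs-+ (evens v) (R a j) (shift (suc a) (R a j′)) m)
         (+-congˡ (Δs (evens v) (R a j) m) (Δs-shift (evens v) (suc a) (R a j′) m))) n ⟩
  Δs (evens u) (λ m → Δs (evens v) (R a j) m + shift (suc a) (Δs (evens v) (R a j′)) m) n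
    ≡⟨ Δs-+ (evens u) (Δs (evens v) (R a j)) (shift (suc a) (Δs (evens v) (R a j′))) n ⟩
  clear u v (R a j) n + Δs (evens u) (shift (suc a) (Δs (evens v) (R a j′))) n
    ≡⟨ +-congˡ (clear u v (R a j) n) (Δs-shift (evens u) (suc a) (Δs (evens v) (R a j′)) n) ⟩
  clear u v (R a j) n + shift (suc a) (clear u v (R a j′)) n
    ≡⟨ cong₂ _+_ (remove u v j u+v d n)
         -- The reflected charge has the opposite difference, so the two runners exchange roles.
         (shift-cong (suc a) (λ m → trans (Δs-comm (evens u) (evens v) (R a j′) m)
            (remove v u j′ (trans (ℕ.+-comm v u) u+v) d′ m)) n) ⟩
  Δ (double u) (mono (exponent j)) n + shift (suc a) (Δ (double v) (mono (exponent j′))) n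
    ≡⟨ cong (λ s → Δ (double u) (mono (exponent j)) n
                   + shift s (Δ (double v) (mono (exponent j′))) n) u+v ⟨
  Δ (double u) (mono (exponent j)) n + shift (u ℕ.+ v) (Δ (double v) (mono (exponent j′))) n
    ≡⟨ mono-telescope u v (exponent j) (exponent j′) (exponent-flip (suc a) u v j d) n ⟩
  Δ (double (u ℕ.+ v)) (mono (exponent j)) n
    ≡⟨ cong (λ s → Δ (double s) (mono (exponent j)) n) u+v ⟩
  Δ k (mono (exponent j)) n ∎)
  where
  k : ℕ
  k = double (suc a)
  j′ : ℤ
  j′ = parity (suc a) - j

  d′ : + v - + u ≡ difference (suc a) j′
  d′ = begin
    + v - + u                ≡⟨ lemma (+ u) (+ v) ⟩
    - (+ u - + v)            ≡⟨ cong -_ d ⟩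
    - difference (suc a) j   ≡⟨ difference-flip (suc a) j ⟨
    difference (suc a) j′    ∎
    where
    lemma : ∀ u v → v - u ≡ - (u - v)
    lemma = solve-∀

  -- The difference one level down is `1 - (u - v) = v - (u - 1)`: a bead leaves the first runner
  -- and the runners swap. The factor for that bead is left over.
  remove : ∀ u v j → u ℕ.+ v ≡ suc a → + u - + v ≡ difference (suc a) j →
    clear u v (R a j) ≐ Δ (double u) (mono (exponent j))
  -- With no bead to remove, the difference one level down is `a + 2`, so `R a j` vanishes, matching
  -- the factor `1 - q^0`.
  remove zero v j refl d n = begin
    Δs (evens v) (R a j) n
      ≡⟨ Δs-cong (evens v) (R-vanish a 0 j (inj₁ difference≡)) n ⟩
    Δs (evens v) (λ _ → + 0) n
      ≡⟨ Δs-zero (evens v) n ⟩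
    + 0
      ≡⟨ ℤ.+-inverseʳ (mono (exponent j) n) ⟨
    Δ 0 (mono (exponent j)) n ∎
    where
    lemma : ∀ a → + 1 - (+ 0 - (+ 1 + a)) ≡ a + + 2
    lemma = solve-∀
    difference≡ : difference a j ≡ + (a ℕ.+ 2)
    difference≡ = begin
      difference a j                ≡⟨ involution₁ (difference a j) ⟨
      + 1 - difference (suc a) j    ≡⟨ cong (λ x → + 1 - x) d ⟨
      + 1 - (+ 0 - (+ 1 + + a))     ≡⟨ lemma (+ a) ⟩
      + a + + 2                     ∎
  remove (suc u) v j u+v d =
    Δ-cong (double (suc u)) (λ n →
      trans (Δs-comm (evens u) (evens v) (R a j) n)
            (clear-R a v u j (trans (ℕ.+-comm v u) (ℕ.suc-injective u+v)) difference≡ n))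
    where
    lemma : ∀ u v → v - u ≡ + 1 - ((+ 1 + u) - v)
    lemma = solve-∀
    difference≡ : + v - + u ≡ difference a j
    difference≡ = begin
      + v - + u                     ≡⟨ lemma (+ u) (+ v) ⟩
      + 1 - (+ suc u - + v)         ≡⟨ cong (λ x → + 1 - x) d ⟩
      + 1 - difference (suc a) j    ≡⟨ involution₁ (difference a j) ⟩
      difference a j                ∎

-- Letting the number of rows grow

difference-double : ∀ c j → difference (double c) j ≡ + 2 * j
difference-double zero j = refl
difference-double (suc c) j rewrite ℕ.+-suc c c =
  trans (involution₁ (difference (double c) j)) (difference-double c j)

-- One runner receives a surplus of `2|j|` beads, which makes the total even and hence the
-- difference `2j`. Both runners carry at least `n` beads, enough for all degrees up to `n`.
beads : ∀ n j → ∃[ c ] ∃[ d ] + (c ℕ.+ n) - + (d ℕ.+ n) ≡ difference (c ℕ.+ n ℕ.+ (d ℕ.+ n)) j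
beads n (+ k) = double k , 0 , (begin
  + (double k ℕ.+ n) - + n ≡⟨ lemma (+ k) (+ n) ⟩
  + 2 * + k                ≡⟨ difference-double (k ℕ.+ n) (+ k) ⟨
  difference (double (k ℕ.+ n)) (+ k) ≡⟨ cong (λ a → difference a (+ k)) (regroup k n) ⟩
  difference (double k ℕ.+ n ℕ.+ n) (+ k) ∎)
  where
  lemma : ∀ k n → ((k + k) + n) - n ≡ + 2 * k
  lemma = solve-∀
  regroup : ∀ k n → k ℕ.+ n ℕ.+ (k ℕ.+ n) ≡ k ℕ.+ k ℕ.+ n ℕ.+ n
  regroup = ℕ-Solver.solve-∀
beads n -[1+ k ] = 0 , double (suc k) , (begin
  + n - + (double (suc k) ℕ.+ n) ≡⟨ lemma (+ suc k) (+ n) ⟩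
  + 2 * -[1+ k ]                 ≡⟨ difference-double (suc k ℕ.+ n) -[1+ k ] ⟨
  difference (double (suc k ℕ.+ n)) -[1+ k ]
    ≡⟨ cong (λ a → difference a -[1+ k ]) (regroup (suc k) n) ⟩
  difference (n ℕ.+ (double (suc k) ℕ.+ n)) -[1+ k ] ∎)
  where
  lemma : ∀ k n → n - ((k + k) + n) ≡ + 2 * - k
  lemma = solve-∀
  regroup : ∀ k n → k ℕ.+ n ℕ.+ (k ℕ.+ n) ≡ n ℕ.+ (k ℕ.+ k ℕ.+ n)
  regroup = ℕ-Solver.solve-∀

-- The extra factors `1 - q^(2i)` have `i > n`, so they act trivially in degrees up to `n`.
Δs-evens-truncate : ∀ c n f m → m ℕ.≤ n → Δs (evens (c ℕ.+ n)) f m ≡ Δs (evens n) f m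
Δs-evens-truncate zero n f m m≤n = refl
Δs-evens-truncate (suc c) n f m m≤n = begin
  F m - shift (double (suc (c ℕ.+ n))) F m
    ≡⟨ cong (λ x → F m - x) (shift-beyond (double (suc (c ℕ.+ n))) F
         (s≤s (ℕ.≤-trans m≤n (ℕ.≤-trans (ℕ.m≤n+m n c) (ℕ.m≤m+n (c ℕ.+ n) (suc (c ℕ.+ n))))))) ⟩
  F m - + 0
    ≡⟨ ℤ.+-identityʳ (F m) ⟩
  F m
    ≡⟨ Δs-evens-truncate c n f m m≤n ⟩
  Δs (evens n) f m ∎
  where
  F : Series
  F = Δs (evens (c ℕ.+ n)) f

mono-rhsNumerator : ∀ j n → mono (exponent j) n ≡ rhsNumerator j n
mono-rhsNumerator j n =
  trans (shift-monomial (exponent j) n)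
        (cong (λ b → if b then + 1 else + 0)
          (⌊⌋-cong (n ℕ.≟ exponent j) (+ n ℤ.≟ binom2j2 j)
             (λ e → trans (cong +_ e) (exponent-binom2j2 j))
             (λ e → ℤ.+-injective (trans e (sym (exponent-binom2j2 j))))))

theorem5p5 : (j : ℤ) (n : ℕ) → (lhs j ⊛ prodTrunc n) n ≡ rhsNumerator j n
theorem5p5 j n with beads n j
... | c , d , difference≡ = begin
  (lhs j ⊛ prodTrunc n) n
    ≡⟨ ⊛-prodTrunc n (lhs j) n ⟩
  clear n n (lhs j) n
    -- Only coefficients of degree at most `n` enter, and there `a ≥ n` rows give all of `lhs`.
    ≡⟨ Δs-cong-≤ (evens n) n (Δs-cong-≤ (evens n) n (λ m m≤n →
         lhs-R j m a (ℕ.≤-trans m≤n (ℕ.≤-trans (ℕ.m≤n+m n c) (ℕ.m≤m+n u v))))) n ℕ.≤-refl ⟩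
  clear n n (R a j) n
    -- The two copies of the product are lengthened to `v` and `u` factors, as `clear-R` requires.
    ≡⟨ Δs-cong-≤ (evens n) n (λ m m≤n → sym (Δs-evens-truncate d n (R a j) m m≤n)) n ℕ.≤-refl ⟩
  clear n v (R a j) n
    ≡⟨ Δs-evens-truncate c n (Δs (evens v) (R a j)) n ℕ.≤-refl ⟨
  clear u v (R a j) n
    ≡⟨ clear-R a u v j refl difference≡ n ⟩
  mono (exponent j) n
    ≡⟨ mono-rhsNumerator j n ⟩
  rhsNumerator j n ∎
  where
  u v a : ℕ
  u = c ℕ.+ n
  v = d ℕ.+ n
  a = u ℕ.+ v
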